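{- Let $G$ be a connected nontrivial graph with $m$ vertices and let $n\geq4$. Then $$\lambda'(G\boxtimes K_n)=\min\{n^2\lambda(G),\ (n-1)(m+2e(G)),\ 2n\delta(G)+2n-4\}.$$
   Context: All graphs are finite, simple and undirected; "nontrivial" means having at least two vertices. $K_n$ denotes the complete graph on $n$ vertices. For a graph $G$: $e(G)=|E(G)|$; $\delta(G)$ is the minimum degree; $\lambda(G)$ is the edge-connectivity. A restricted edge-cut of a connected graph $G$ is a set $S\subseteq E(G)$ such that $G-S$ is disconnected and every component of $G-S$ has at least $2$ vertices; the restricted edge-connectivity $\lambda'(G)$ is the minimum cardinality of a restricted edge-cut. The strong product $G\boxtimes H$ has vertex set $V(G)\times V(H)$, with $(x_1,y_1)$ and $(x_2,y_2)$ adjacent iff either $x_1=x_2$ and $y_1y_2\in E(H)$, or $y_1=y_2$ and $x_1x_2\in E(G)$, or $x_1x_2\in E(G)$ and $y_1y_2\in E(H)$. -}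

module Defs where

open import Data.Fin.Base using (Fin; remQuot)
open import Data.Fin.Properties using (_≟_; _<?_; any?; all?)
open import Data.Fin.Subset using (Subset; inside; outside; _∈_; ∣_∣)
open import Data.Fin.Subset.Properties using (_∈?_)
open import Data.List.Base using (List; []; _∷_; [_]; _++_; map; filter; foldr; length; lookup; allFin; cartesianProduct)
open import Data.List.Membership.Propositional using () renaming (_∈_ to _∈ₗ_)
open import Data.List.Membership.Propositional.Properties using (∈-allFin)
open import Data.List.Relation.Unary.Any using (here; there)
open import Data.Maybe.Base using (Maybe; just; nothing; fromMaybe)
open import Data.Nat.Base using (ℕ; zero; suc; _*_; _≤_; _⊓_)
open import Data.Nat.Properties using (_≤?_)
open import Data.Product.Base using (_×_; _,_; ∃)
open import Data.Product.Properties using (≡-dec)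
open import Data.Sum.Base using (_⊎_; inj₁; inj₂)
open import Data.Vec.Base as Vec using (tabulate)
open import Function.Base using (_∘_; _on_)
open import Level using (0ℓ)
open import Relation.Binary.Core using (Rel)
open import Relation.Binary.Construct.Closure.ReflexiveTransitive using (Star; ε; _◅_; _◅◅_)
open import Relation.Binary.Definitions using (Symmetric; Irreflexive; Decidable)
open import Relation.Binary.PropositionalEquality using (_≡_; _≢_; refl; sym; ≢-sym)
open import Relation.Nullary.Decidable using (Dec; does; map′; ¬?; _×-dec_; _⊎-dec_)
open import Relation.Nullary.Negation using (¬_)
open import Relation.Unary using (Pred) renaming (Decidable to Decidable₁)

private
  variable
    m n : ℕ

comprehension : {P : Pred (Fin n) 0ℓ} → Decidable₁ P → Subset n
comprehension P? = tabulate (does ∘ P?)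

subsets : ∀ n → List (Subset n)
subsets zero    = [ Vec.[] ]
subsets (suc n) = map (inside Vec.∷_) (subsets n) ++ map (outside Vec.∷_) (subsets n)

minimum : List ℕ → Maybe ℕ
minimum []       = nothing
minimum (x ∷ xs) = just (foldr _⊓_ x xs)

-- Decidability of the reflexive transitive closure on Fin n, by the
-- Floyd–Warshall recursion: Via ws u v says that there is a walk from u
-- to v all of whose intermediate vertices lie in ws.
module Warshall {R : Rel (Fin n) 0ℓ} (R? : Decidable R) where

  Via : List (Fin n) → Rel (Fin n) 0ℓ
  Via []       u v = u ≡ v ⊎ R u v
  Via (w ∷ ws) u v = Via ws u v ⊎ (Via ws u w × Via ws w v)

  via? : ∀ ws → Decidable (Via ws)
  via? []       u v = (u ≟ v) ⊎-dec R? u v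
  via? (w ∷ ws) u v = via? ws u v ⊎-dec (via? ws u w ×-dec via? ws w v)

  via⇒star : ∀ ws {u v} → Via ws u v → Star R u v
  via⇒star []       (inj₁ refl)    = ε
  via⇒star []       (inj₂ r)       = r ◅ ε
  via⇒star (w ∷ ws) (inj₁ p)       = via⇒star ws p
  via⇒star (w ∷ ws) (inj₂ (p , q)) = via⇒star ws p ◅◅ via⇒star ws q

  via-base : ∀ ws {u v} → Via [] u v → Via ws u v
  via-base []       p = p
  via-base (w ∷ ws) p = inj₁ (via-base ws p)

  via-trans : ∀ {ws w u v} → w ∈ₗ ws → Via ws u w → Via ws w v → Via ws u v
  via-trans (here refl) (inj₁ p)       (inj₁ q)       = inj₂ (p , q)
  via-trans (here refl) (inj₁ p)       (inj₂ (_ , q)) = inj₂ (p , q)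
  via-trans (here refl) (inj₂ (p , _)) (inj₁ q)       = inj₂ (p , q)
  via-trans (here refl) (inj₂ (p , _)) (inj₂ (_ , q)) = inj₂ (p , q)
  via-trans (there i)   (inj₁ p)       (inj₁ q)       = inj₁ (via-trans i p q)
  via-trans (there i)   (inj₁ p)       (inj₂ (q , r)) = inj₂ (via-trans i p q , r)
  via-trans (there i)   (inj₂ (p , q)) (inj₁ r)       = inj₂ (p , via-trans i q r)
  via-trans (there i)   (inj₂ (p , _)) (inj₂ (_ , q)) = inj₂ (p , q)

  star⇒via : ∀ {u v} → Star R u v → Via (allFin n) u v
  star⇒via ε       = via-base (allFin n) (inj₁ refl)
  star⇒via (r ◅ s) = via-trans (∈-allFin _) (via-base (allFin n) (inj₂ r)) (star⇒via s)

  star? : Decidable (Star R)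
  star? u v = map′ (via⇒star (allFin n)) star⇒via (via? (allFin n) u v)

record Graph (n : ℕ) : Set₁ where
  field
    _~_      : Rel (Fin n) 0ℓ
    _~?_     : Decidable _~_
    ~-sym    : Symmetric _~_
    ~-irrefl : Irreflexive _≡_ _~_

  Reachable : Rel (Fin n) 0ℓ
  Reachable = Star _~_

  reachable? : Decidable Reachable
  reachable? = Warshall.star? _~?_

  Connected : Set
  Connected = ∀ u v → Reachable u v

  connected? : Dec Connected
  connected? = all? λ u → all? λ v → reachable? u v

  component : Fin n → Subset n
  component u = comprehension (reachable? u)

  neighbourhood : Fin n → Subset n
  neighbourhood u = comprehension (u ~?_)

  degree : Fin n → ℕ
  degree u = ∣ neighbourhood u ∣

  -- The default value is used only for the graph without vertices.
  δ : ℕ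
  δ = fromMaybe 0 (minimum (map degree (allFin n)))

  -- Each edge is listed once, as the pair (u , v) of its ends with u < v.
  edges : List (Fin n × Fin n)
  edges = filter (λ (u , v) → (u <? v) ×-dec (u ~? v))
                 (cartesianProduct (allFin n) (allFin n))

  e : ℕ
  e = length edges

  -- A set of edges is a set of positions in the list edges.
  EdgeSet : Set
  EdgeSet = Subset e

  _joins_and_ : Fin e → Fin n → Fin n → Set
  i joins u and v = lookup edges i ≡ (u , v) ⊎ lookup edges i ≡ (v , u)

  Contains : EdgeSet → Rel (Fin n) 0ℓ
  Contains S u v = ∃ λ i → i ∈ S × i joins u and v

  contains? : ∀ S → Decidable (Contains S)
  contains? S u v = any? λ i →
    (i ∈? S) ×-dec (≡-dec _≟_ _≟_ (lookup edges i) (u , v) ⊎-dec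
                    ≡-dec _≟_ _≟_ (lookup edges i) (v , u))

  contains-sym : ∀ S → Symmetric (Contains S)
  contains-sym S (i , i∈S , inj₁ p) = i , i∈S , inj₂ p
  contains-sym S (i , i∈S , inj₂ p) = i , i∈S , inj₁ p

open Graph public using (Connected; connected?; component; δ; e; EdgeSet)

infixl 6 _-_

_-_ : (G : Graph n) → EdgeSet G → Graph n
G - S = record
  { _~_      = λ u v → u ~ v × ¬ Contains S u v
  ; _~?_     = λ u v → (u ~? v) ×-dec ¬? (contains? S u v)
  ; ~-sym    = λ (p , q) → ~-sym p , q ∘ contains-sym S
  ; ~-irrefl = λ u≡v (p , _) → ~-irrefl u≡v p
  }
  where open Graph G

module _ (G : Graph n) where

  IsEdgeCut : Pred (EdgeSet G) 0ℓ
  IsEdgeCut S = ¬ Connected (G - S)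

  isEdgeCut? : Decidable₁ IsEdgeCut
  isEdgeCut? S = ¬? (connected? (G - S))

  -- The components of a graph are the components of its vertices.
  IsRestrictedEdgeCut : Pred (EdgeSet G) 0ℓ
  IsRestrictedEdgeCut S =
    ¬ Connected (G - S) × (∀ u → 2 ≤ ∣ component (G - S) u ∣)

  isRestrictedEdgeCut? : Decidable₁ IsRestrictedEdgeCut
  isRestrictedEdgeCut? S =
    ¬? (connected? (G - S)) ×-dec all? λ u → 2 ≤? ∣ component (G - S) u ∣

  -- A graph has no edge-cut only if it has at most one vertex; its
  -- edge-connectivity is then 0.
  edgeConnectivity : ℕ
  edgeConnectivity =
    fromMaybe 0 (minimum (map ∣_∣ (filter isEdgeCut? (subsets (e G)))))

  -- nothing if G has no restricted edge-cut (for example, if G is a star).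
  restrictedEdgeConnectivity : Maybe ℕ
  restrictedEdgeConnectivity =
    minimum (map ∣_∣ (filter isRestrictedEdgeCut? (subsets (e G))))

K : ∀ n → Graph n
K n = record
  { _~_      = _≢_
  ; _~?_     = λ u v → ¬? (u ≟ v)
  ; ~-sym    = ≢-sym
  ; ~-irrefl = λ u≡v u≢v → u≢v u≡v
  }

module _ (G : Graph m) (H : Graph n) where

  private
    module G = Graph G
    module H = Graph H

  StrongAdj : Rel (Fin m × Fin n) 0ℓ
  StrongAdj (x₁ , y₁) (x₂ , y₂) =
    (x₁ ≡ x₂ × y₁ H.~ y₂) ⊎ (y₁ ≡ y₂ × x₁ G.~ x₂) ⊎ (x₁ G.~ x₂ × y₁ H.~ y₂)

  strongAdj? : Decidable StrongAdj
  strongAdj? (x₁ , y₁) (x₂ , y₂) =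
    ((x₁ ≟ x₂) ×-dec (y₁ H.~? y₂)) ⊎-dec
    (((y₁ ≟ y₂) ×-dec (x₁ G.~? x₂)) ⊎-dec ((x₁ G.~? x₂) ×-dec (y₁ H.~? y₂)))

  strongAdj-sym : Symmetric StrongAdj
  strongAdj-sym (inj₁ (p , q))        = inj₁ (sym p , H.~-sym q)
  strongAdj-sym (inj₂ (inj₁ (p , q))) = inj₂ (inj₁ (sym p , G.~-sym q))
  strongAdj-sym (inj₂ (inj₂ (p , q))) = inj₂ (inj₂ (G.~-sym p , H.~-sym q))

  strongAdj-irrefl : Irreflexive _≡_ StrongAdj
  strongAdj-irrefl refl (inj₁ (_ , q))        = H.~-irrefl refl q
  strongAdj-irrefl refl (inj₂ (inj₁ (_ , q))) = G.~-irrefl refl q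
  strongAdj-irrefl refl (inj₂ (inj₂ (_ , q))) = H.~-irrefl refl q

  infixl 7 _⊠_

  -- Fin (m * n) stands for Fin m × Fin n through the bijection remQuot n.
  _⊠_ : Graph (m * n)
  _⊠_ = record
    { _~_      = StrongAdj on remQuot n
    ; _~?_     = λ u v → strongAdj? (remQuot n u) (remQuot n v)
    ; ~-sym    = strongAdj-sym
    ; ~-irrefl = λ { refl → strongAdj-irrefl refl }
    }

{-# OPTIONS --safe #-}
module Submission where

-- Let A be a vertex set of G ⊠ K n that has p x vertices in the fibre over x
-- and misses q x = n - p x of them.  Its boundary has
--   Σ_x p x q x + Σ_(x ~ y) p x q y
-- edges, the second sum running over ordered pairs.  If some fibre lies in A
-- and some fibre is disjoint from A, the second sum is at least
-- n Σ_(x ~ y) max(p x - p y, 0), which is n times the total boundary of the n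
-- level sets {p > t}, t < n, each of size at least λ(G); this gives n²λ(G).
-- Otherwise, up to complementing A, no fibre lies in A.  If A meets only one
-- fibre, a direct estimate gives 2nδ + 2n - 4; if not, each vertex u of the
-- support of p contributes at least (n - 1)(1 + deg u) plus the number of
-- its neighbours outside the support, and two or three vertices suffice.
-- The bounds are attained by cylinders T × V(K n) over minimum cuts T of G and
-- by the two ends of an edge in a fibre over a vertex of minimum degree.  The
-- term (n - 1)(m + 2e), the boundary of a layer, is never below 2nδ + 2n - 4.

open import Data.Bool.Base using (Bool; true; false; not; _∧_; _xor_)
open import Data.Bool.Properties using () renaming (_≟_ to _≟ᵇ_)
open import Data.Fin.Base using (Fin; zero; suc; toℕ; combine; remQuot; _↑ˡ_; _↑ʳ_; _<_)
open import Data.Fin.Properties using (_≟_; _<?_; <-cmp; <-asym; ¬∀⟶∃¬; all?; any?; toℕ<n; remQuot-combine)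
open import Data.Fin.Subset using (Subset; inside; outside; ∣_∣) renaming (_∈_ to _∈ₛ_)
open import Data.Fin.Subset.Properties using (_∈?_; p⊆q⇒∣p∣≤∣q∣)
open import Data.List.Base as List using (List; []; _∷_; map; filter; foldr; length; lookup; tabulate; allFin; cartesianProduct)
open import Data.List.Membership.Propositional using (_∈_)
open import Data.List.Membership.Propositional.Properties using (∈-map⁺; ∈-map⁻; ∈-++⁺ˡ; ∈-++⁺ʳ; ∈-filter⁺; ∈-filter⁻; ∈-lookup; ∈-allFin; ∈-cartesianProduct⁺; foldr-selective)
open import Data.List.Properties using (map-++; map-∘; map-tabulate; foldr-preservesᵒ)
open import Data.List.Relation.Unary.All as All using ()
open import Data.List.Relation.Unary.AllPairs using (_∷_)
open import Data.List.Relation.Unary.Any as Any using (here; there; index)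
open import Data.List.Relation.Unary.Any.Properties using (lookup-index)
open import Data.List.Relation.Unary.Unique.Propositional using (Unique)
open import Data.List.Relation.Unary.Unique.Propositional.Properties using (allFin⁺; cartesianProduct⁺; filter⁺)
open import Data.Maybe.Base using (just; fromMaybe)
open import Data.Nat.Base as ℕ using (ℕ; zero; suc; _+_; _*_; _∸_; _^_; _≤_; _<ᵇ_; _⊓_; z≤n; s≤s; s≤s⁻¹)
open import Data.Nat.ListAction using (sum)
open import Data.Nat.ListAction.Properties using (sum-++)
import Data.Nat.Properties as ℕ
open import Data.Nat.Properties hiding (_≟_; _<?_; <-cmp; <-asym)
open import Data.Nat.Tactic.RingSolver using (solve-∀)
open import Data.Product.Base using (_×_; _,_; ∃; ∃₂; proj₁; proj₂)
open import Data.Sum.Base using (_⊎_; inj₁; inj₂; [_,_]′)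
import Data.Vec.Base as Vec
open import Data.Vec.Properties using (lookup∘tabulate; []=⇒lookup; lookup⇒[]=)
open import Function.Base using (_∘_; id)
open import Function.Bundles using (mk⇔)
open import Level using (0ℓ)
open import Relation.Binary.Construct.Closure.ReflexiveTransitive using (Star; ε; _◅_; _◅◅_; reverse)
open import Relation.Binary.Definitions using (tri<; tri≈; tri>)
open import Relation.Binary.PropositionalEquality using (_≡_; _≢_; refl; sym; trans; cong; cong₂; subst; subst₂; ≢-sym; module ≡-Reasoning)
open import Relation.Nullary using (Dec; does; yes; no; ¬_; contradiction)
open import Relation.Nullary.Decidable using (dec-true; dec-false; decidable-stable; does-⇔; ¬?; _×-dec_)
open import Relation.Unary using (Pred; Decidable)

open import Algebra.Properties.Semiring.Sum +-*-semiring using (∑-distrib-+; ∑-comm; sum-cong-≗; *-distribˡ-sum; *-distribʳ-sum; sum-replicate-zero; sum-syntax) renaming (sum to ∑)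

open import Defs

private
  variable
    k m n : ℕ

-- Finite sums

𝟙 : Bool → ℕ
𝟙 true  = 1
𝟙 false = 0

𝟙-excluded : ∀ x → 𝟙 x * 𝟙 (not x) ≡ 0
𝟙-excluded true  = refl
𝟙-excluded false = refl

𝟙-partition : ∀ x → 𝟙 x + 𝟙 (not x) ≡ 1
𝟙-partition true  = refl
𝟙-partition false = refl

𝟙-disjoint : {P Q : Set} (P? : Dec P) (Q? : Dec Q) → (P → ¬ Q) → 𝟙 (does P?) ≤ 𝟙 (not (does Q?))
𝟙-disjoint (yes p) (yes q) P⇒¬Q = contradiction q (P⇒¬Q p)
𝟙-disjoint (yes _) (no _)  _    = ≤-refl
𝟙-disjoint (no _)  _       _    = z≤n

∑-mono-≤ : {f g : Fin n → ℕ} → (∀ i → f i ≤ g i) → ∑ f ≤ ∑ g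
∑-mono-≤ {zero}  f≤g = z≤n
∑-mono-≤ {suc n} f≤g = +-mono-≤ (f≤g zero) (∑-mono-≤ (f≤g ∘ suc))

∑-const : ∀ n c → ∑[ i < n ] c ≡ n * c
∑-const zero    c = refl
∑-const (suc n) c = cong (c +_) (∑-const n c)

∑-indicator : ∀ (u : Fin n) (h : Fin n → ℕ) → ∑[ x < n ] (𝟙 (does (x ≟ u)) * h x) ≡ h u
∑-indicator {suc n} zero    h = trans (cong₂ _+_ (*-identityˡ (h zero)) (sum-replicate-zero n)) (+-identityʳ (h zero))
∑-indicator {suc n} (suc u) h = ∑-indicator u (h ∘ suc)

𝟙*-≤ : ∀ b c → 𝟙 b * c ≤ c
𝟙*-≤ true  c = ≤-reflexive (*-identityˡ c)
𝟙*-≤ false c = z≤n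

∑-single : (h : Fin n → ℕ) (u : Fin n) → h u ≤ ∑ h
∑-single {n} h u = subst (_≤ ∑ h) (∑-indicator u h) (∑-mono-≤ λ x → 𝟙*-≤ (does (x ≟ u)) (h x))

∑-two : (h : Fin n → ℕ) {u v : Fin n} → u ≢ v → h u + h v ≤ ∑ h
∑-two {n} h {u} {v} u≢v = begin
  h u + h v
    ≡⟨ cong₂ _+_ (∑-indicator u h) (∑-indicator v h) ⟨
  ∑[ x < n ] (𝟙 (does (x ≟ u)) * h x) + ∑[ x < n ] (𝟙 (does (x ≟ v)) * h x)
    ≡⟨ ∑-distrib-+ (λ x → 𝟙 (does (x ≟ u)) * h x) _ ⟨
  ∑[ x < n ] (𝟙 (does (x ≟ u)) * h x + 𝟙 (does (x ≟ v)) * h x)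
    ≤⟨ ∑-mono-≤ pointwise ⟩
  ∑ h ∎
  where
  open ≤-Reasoning
  pointwise : ∀ x → 𝟙 (does (x ≟ u)) * h x + 𝟙 (does (x ≟ v)) * h x ≤ h x
  pointwise x with x ≟ u | x ≟ v
  ... | yes refl | yes refl = contradiction refl u≢v
  ... | yes _    | no _     = ≤-reflexive (trans (+-identityʳ _) (*-identityˡ (h x)))
  ... | no _     | yes _    = ≤-reflexive (*-identityˡ (h x))
  ... | no _     | no _     = z≤n

-- Zeroing `h` at `w` gives `h′`, which still agrees with `h` at `u` and `v`. So `∑-two` applies to
-- `h′`, and the entry removed at `w` is added back.
∑-three : (h : Fin n → ℕ) {u v w : Fin n} → u ≢ v → w ≢ u → w ≢ v → h u + h v + h w ≤ ∑ h
∑-three {n} h {u} {v} {w} u≢v w≢u w≢v = begin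
  h u + h v + h w
    ≡⟨ cong₂ _+_ (cong₂ _+_ (off u (≢-sym w≢u)) (off v (≢-sym w≢v))) (∑-indicator w h) ⟨
  h′ u + h′ v + ∑[ x < n ] (𝟙 (does (x ≟ w)) * h x)
    ≤⟨ +-monoˡ-≤ _ (∑-two h′ u≢v) ⟩
  ∑ h′ + ∑[ x < n ] (𝟙 (does (x ≟ w)) * h x)
    ≡⟨ ∑-distrib-+ h′ _ ⟨
  ∑[ x < n ] (h′ x + 𝟙 (does (x ≟ w)) * h x)
    ≤⟨ ∑-mono-≤ pointwise ⟩
  ∑ h ∎
  where
  open ≤-Reasoning
  h′ : Fin n → ℕ
  h′ x = 𝟙 (not (does (x ≟ w))) * h x

  off : ∀ x → x ≢ w → h′ x ≡ h x
  off x x≢w rewrite dec-false (x ≟ w) x≢w = *-identityˡ (h x)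

  pointwise : ∀ x → h′ x + 𝟙 (does (x ≟ w)) * h x ≤ h x
  pointwise x with does (x ≟ w)
  ... | true  = ≤-reflexive (*-identityˡ (h x))
  ... | false = ≤-reflexive (trans (+-identityʳ _) (*-identityˡ (h x)))

two-elements : (f : Fin n → Bool) {u v : Fin n} → u ≢ v → f u ≡ true → f v ≡ true → 2 ≤ ∑[ x < n ] 𝟙 (f x)
two-elements {n} f {u} {v} u≢v fu fv =
  subst (_≤ ∑[ x < n ] 𝟙 (f x)) (cong₂ (λ x y → 𝟙 x + 𝟙 y) fu fv) (∑-two (𝟙 ∘ f) u≢v)

∑-↑ : ∀ m (g : Fin (m + n) → ℕ) → ∑ g ≡ ∑[ i < m ] g (i ↑ˡ n) + ∑[ j < n ] g (m ↑ʳ j)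
∑-↑ zero    g = refl
∑-↑ (suc m) g = trans (cong (g zero +_) (∑-↑ m (g ∘ suc))) (sym (+-assoc (g zero) _ _))

∑-combine : ∀ m n (g : Fin (m * n) → ℕ) → ∑ g ≡ ∑[ x < m ] ∑[ i < n ] g (combine x i)
∑-combine zero    n g = refl
∑-combine (suc m) n g = trans (∑-↑ n g) (cong (∑[ i < n ] g (i ↑ˡ (m * n)) +_) (∑-combine m n (g ∘ (n ↑ʳ_))))

∣tabulate∣ : (f : Fin n → Bool) → ∣ Vec.tabulate f ∣ ≡ ∑[ i < n ] 𝟙 (f i)
∣tabulate∣ {zero}  f = refl
∣tabulate∣ {suc n} f with f zero
... | true  = cong suc (∣tabulate∣ (f ∘ suc))
... | false = ∣tabulate∣ (f ∘ suc)

module _ {A : Set} where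

  ∑-lookup : (W : A → ℕ) (xs : List A) → ∑[ i < length xs ] W (lookup xs i) ≡ sum (map W xs)
  ∑-lookup W []       = refl
  ∑-lookup W (x ∷ xs) = cong (W x +_) (∑-lookup W xs)

  sum-filter : {P : Pred A 0ℓ} (P? : Decidable P) (W : A → ℕ) (xs : List A) →
    sum (map W (filter P? xs)) ≡ sum (map (λ x → 𝟙 (does (P? x)) * W x) xs)
  sum-filter P? W []       = refl
  sum-filter P? W (x ∷ xs) with does (P? x)
  ... | true  = cong₂ _+_ (sym (*-identityˡ (W x))) (sum-filter P? W xs)
  ... | false = sum-filter P? W xs

  sum-cartesianProduct : {B : Set} (W : A × B → ℕ) (xs : List A) (ys : List B) →
    sum (map W (cartesianProduct xs ys)) ≡ sum (map (λ x → sum (map (λ y → W (x , y)) ys)) xs)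
  sum-cartesianProduct W []       ys = refl
  sum-cartesianProduct W (x ∷ xs) ys = begin
    sum (map W (map (x ,_) ys List.++ cartesianProduct xs ys))
      ≡⟨ cong sum (map-++ W (map (x ,_) ys) _) ⟩
    sum (map W (map (x ,_) ys) List.++ map W (cartesianProduct xs ys))
      ≡⟨ sum-++ (map W (map (x ,_) ys)) _ ⟩
    sum (map W (map (x ,_) ys)) + sum (map W (cartesianProduct xs ys))
      ≡⟨ cong₂ _+_ (cong sum (sym (map-∘ ys))) (sum-cartesianProduct W xs ys) ⟩
    sum (map (λ y → W (x , y)) ys) + sum (map (λ x → sum (map (λ y → W (x , y)) ys)) xs) ∎
    where open ≡-Reasoning

sum-tabulate : (f : Fin n → ℕ) → sum (tabulate f) ≡ ∑ f
sum-tabulate {zero}  f = refl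
sum-tabulate {suc n} f = cong (f zero +_) (sum-tabulate (f ∘ suc))

sum-allFin : (f : Fin n → ℕ) → sum (map f (allFin n)) ≡ ∑ f
sum-allFin f = trans (cong sum (map-tabulate id f)) (sum-tabulate f)

-- Minima

-- The member `x` rules out the empty list, the only one for which `minimum` is `nothing`.
minimum-spec : ∀ {x xs} → x ∈ xs → ∃ λ v → minimum xs ≡ just v × v ∈ xs × (∀ {y} → y ∈ xs → v ≤ y)
minimum-spec {xs = z ∷ zs} _ = v , refl , attained , lower
  where
  v : ℕ
  v = foldr _⊓_ z zs

  attained : v ∈ z ∷ zs
  attained = [ here , there ]′ (foldr-selective ⊓-sel z zs)

  ⊓-≤ : ∀ {y} a b → a ≤ y ⊎ b ≤ y → a ⊓ b ≤ y
  ⊓-≤ a b (inj₁ a≤y) = ≤-trans (m⊓n≤m a b) a≤y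
  ⊓-≤ a b (inj₂ b≤y) = ≤-trans (m⊓n≤n a b) b≤y

  lower : ∀ {y} → y ∈ z ∷ zs → v ≤ y
  lower (here refl) = foldr-preservesᵒ ⊓-≤ z zs (inj₁ ≤-refl)
  lower (there y∈)  = foldr-preservesᵒ ⊓-≤ z zs (inj₂ (Any.map (≤-reflexive ∘ sym) y∈))

∈-subsets : (S : Subset n) → S ∈ subsets n
∈-subsets Vec.[]          = here refl
∈-subsets (true  Vec.∷ S) = ∈-++⁺ˡ (∈-map⁺ (inside Vec.∷_) (∈-subsets S))
∈-subsets (false Vec.∷ S) = ∈-++⁺ʳ (map (inside Vec.∷_) (subsets _)) (∈-map⁺ (outside Vec.∷_) (∈-subsets S))

minimum-size-spec : {P : Pred (Subset k) 0ℓ} (P? : Decidable P) {S : Subset k} → P S →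
  ∃ λ v → minimum (map ∣_∣ (filter P? (subsets k))) ≡ just v
        × (∃ λ S₀ → P S₀ × ∣ S₀ ∣ ≡ v) × (∀ S → P S → v ≤ ∣ S ∣)
minimum-size-spec {k} {P} P? pS with minimum-spec (∈-map⁺ ∣_∣ (∈-filter⁺ P? (∈-subsets _) pS))
... | v , eq , v∈ , lower with ∈-map⁻ ∣_∣ v∈
... | S₀ , S₀∈ , v≡ = v , eq , (S₀ , proj₂ (∈-filter⁻ P? {xs = subsets k} S₀∈) , sym v≡) ,
                      λ S pS → lower (∈-map⁺ ∣_∣ (∈-filter⁺ P? (∈-subsets S) pS))

⊓-attained : {P : Pred (Subset k) 0ℓ} {c d : ℕ} →
  (∃ λ S → P S × ∣ S ∣ ≤ c) → (∃ λ S → P S × ∣ S ∣ ≤ d) → ∃ λ S → P S × ∣ S ∣ ≤ c ⊓ d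
⊓-attained {c = c} {d} (S , pS , S≤c) (S′ , pS′ , S′≤d) with ⊓-sel c d
... | inj₁ ≡c = S , pS , subst (∣ S ∣ ≤_) (sym ≡c) S≤c
... | inj₂ ≡d = S′ , pS′ , subst (∣ S′ ∣ ≤_) (sym ≡d) S′≤d

-- The given set need only have size at most `c`: it bounds the minimum from above, and the lower
-- bound applied to a minimiser `S₀` gives the other inequality.
minimum-size : {P : Pred (Subset k) 0ℓ} (P? : Decidable P) {c : ℕ} →
  (∃ λ S → P S × ∣ S ∣ ≤ c) → (∀ S → P S → c ≤ ∣ S ∣) →
  minimum (map ∣_∣ (filter P? (subsets k))) ≡ just c
minimum-size P? (S , pS , S≤c) lower =
  let v , eq , (S₀ , pS₀ , ∣S₀∣≡v) , v≤ = minimum-size-spec P? pS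
  in trans eq (cong just (≤-antisym (≤-trans (v≤ S pS) S≤c) (≤-trans (lower S₀ pS₀) (≤-reflexive ∣S₀∣≡v))))

-- Edge cuts

-- Edge sets are sets of positions in `edges`; this turns equality of edges back into equality of
-- positions.
lookup-injective : {A : Set} {xs : List A} → Unique xs → ∀ i j → lookup xs i ≡ lookup xs j → i ≡ j
lookup-injective (x∉ ∷ _)  zero    zero    eq = refl
lookup-injective (x∉ ∷ _)  zero    (suc j) eq = contradiction eq (All.lookup x∉ (∈-lookup j))
lookup-injective (x∉ ∷ _)  (suc i) zero    eq = contradiction (sym eq) (All.lookup x∉ (∈-lookup i))
lookup-injective (_ ∷ uxs) (suc i) (suc j) eq = cong suc (lookup-injective uxs i j eq)

∈-tabulate⁺ : (f : Fin n → Bool) {i : Fin n} → f i ≡ true → i ∈ₛ Vec.tabulate f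
∈-tabulate⁺ f {i} eq = lookup⇒[]= i _ (trans (lookup∘tabulate f i) eq)

∈-tabulate⁻ : (f : Fin n → Bool) {i : Fin n} → i ∈ₛ Vec.tabulate f → f i ≡ true
∈-tabulate⁻ f {i} i∈ = trans (sym (lookup∘tabulate f i)) ([]=⇒lookup i∈)

xor-≢ : ∀ {x y} → x ≢ y → x xor y ≡ true
xor-≢ {true}  {true}  x≢y = contradiction refl x≢y
xor-≢ {true}  {false} x≢y = refl
xor-≢ {false} {true}  x≢y = refl
xor-≢ {false} {false} x≢y = contradiction refl x≢y

xor-≡ : ∀ {x y} → x xor y ≡ true → x ≢ y
xor-≡ {true}  () refl
xor-≡ {false} () refl

module Cuts (G : Graph n) where

  open Graph G hiding (Connected; connected?; component; δ; e; EdgeSet)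

  src tgt : Fin (e G) → Fin n
  src i = proj₁ (lookup edges i)
  tgt i = proj₂ (lookup edges i)

  adj : Fin n → Fin n → ℕ
  adj u v = 𝟙 (does (u ~? v))

  adj-sym : ∀ u v → adj u v ≡ adj v u
  adj-sym u v = cong 𝟙 (does-⇔ (mk⇔ ~-sym ~-sym) (u ~? v) (v ~? u))

  -- A sum over ordered pairs of adjacent vertices: an edge `uv` enters twice, with weights `w u v`
  -- and `w v u`.
  adjSum : (Fin n → Fin n → ℕ) → ℕ
  adjSum w = ∑[ u < n ] ∑[ v < n ] (adj u v * w u v)

  adjSum-mono-≤ : {w w′ : Fin n → Fin n → ℕ} → (∀ {u v} → u ~ v → w u v ≤ w′ u v) → adjSum w ≤ adjSum w′
  adjSum-mono-≤ {w} {w′} w≤w′ = ∑-mono-≤ λ u → ∑-mono-≤ λ v → lemma u v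
    where
    lemma : ∀ u v → adj u v * w u v ≤ adj u v * w′ u v
    lemma u v with u ~? v
    ... | yes p = *-monoʳ-≤ 1 (w≤w′ p)
    ... | no _  = z≤n

  adjSum-+ : ∀ w w′ → adjSum (λ u v → w u v + w′ u v) ≡ adjSum w + adjSum w′
  adjSum-+ w w′ = trans
    (sum-cong-≗ λ u → trans (sum-cong-≗ λ v → *-distribˡ-+ (adj u v) _ _) (∑-distrib-+ (λ v → adj u v * w u v) _))
    (∑-distrib-+ (λ u → ∑[ v < n ] (adj u v * w u v)) _)

  adjSum-transpose : ∀ w → adjSum (λ u v → w v u) ≡ adjSum w
  adjSum-transpose w = trans (∑-comm (λ u v → adj u v * w v u))
    (sum-cong-≗ λ u → sum-cong-≗ λ v → cong (_* w u v) (adj-sym v u))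

  adjSum-const : ∀ c w → adjSum (λ u v → c * w u v) ≡ c * adjSum w
  adjSum-const c w = sym (trans (*-distribˡ-sum c (λ u → ∑[ v < n ] (adj u v * w u v)))
    (sum-cong-≗ λ u → trans (*-distribˡ-sum c (λ v → adj u v * w u v)) (sum-cong-≗ λ v → swap-* c (adj u v) (w u v))))
    where
    swap-* : ∀ x y z → x * (y * z) ≡ y * (x * z)
    swap-* x y z = trans (sym (*-assoc x y z)) (trans (cong (_* z) (*-comm x y)) (*-assoc y x z))

  -- Transposing the weight does not change `adjSum`, so the two orientations of each edge may be
  -- compared together. This yields the inequality doubled, and the factor 2 cancels.
  adjSum-mono-sym : {w w′ : Fin n → Fin n → ℕ} →
    (∀ {u v} → u ~ v → w u v + w v u ≤ w′ u v + w′ v u) → adjSum w ≤ adjSum w′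
  adjSum-mono-sym {w} {w′} w≤w′ = *-cancelˡ-≤ 2 (begin
    2 * adjSum w                       ≡⟨ double w ⟩
    adjSum (λ u v → w u v + w v u)     ≤⟨ adjSum-mono-≤ w≤w′ ⟩
    adjSum (λ u v → w′ u v + w′ v u)   ≡⟨ double w′ ⟨
    2 * adjSum w′ ∎)
    where
    open ≤-Reasoning
    double : ∀ w → 2 * adjSum w ≡ adjSum (λ u v → w u v + w v u)
    double w = trans (cong (adjSum w +_) (trans (+-identityʳ _) (sym (adjSum-transpose w)))) (sym (adjSum-+ w _))

  -- Exactly one orientation of each edge is listed, so `L u v + L v u` equals `adj u v`. Exchanging
  -- the summation variables in the second half of the double sum brings both halves to the weight
  -- `w u v`.
  adjSum-edges : ∀ w → ∑[ i < e G ] (w (src i) (tgt i) + w (tgt i) (src i)) ≡ adjSum w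
  adjSum-edges w = begin
    ∑[ i < e G ] W (lookup edges i)
      ≡⟨ ∑-lookup W edges ⟩
    sum (map W edges)
      ≡⟨ sum-filter (λ (u , v) → (u <? v) ×-dec (u ~? v)) W (cartesianProduct (allFin n) (allFin n)) ⟩
    sum (map (λ (u , v) → L u v * W (u , v)) (cartesianProduct (allFin n) (allFin n)))
      ≡⟨ sum-cartesianProduct (λ (u , v) → L u v * W (u , v)) (allFin n) (allFin n) ⟩
    sum (map (λ u → sum (map (λ v → L u v * W (u , v)) (allFin n))) (allFin n))
      ≡⟨ sum-allFin (λ u → sum (map (λ v → L u v * W (u , v)) (allFin n))) ⟩
    ∑[ u < n ] sum (map (λ v → L u v * W (u , v)) (allFin n))
      ≡⟨ sum-cong-≗ (λ u → sum-allFin (λ v → L u v * W (u , v))) ⟩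
    ∑[ u < n ] ∑[ v < n ] (L u v * (w u v + w v u))
      ≡⟨ ∑∑-distrib (λ u v → *-distribˡ-+ (L u v) (w u v) (w v u)) ⟩
    ∑[ u < n ] ∑[ v < n ] (L u v * w u v) + ∑[ u < n ] ∑[ v < n ] (L u v * w v u)
      ≡⟨ cong (∑[ u < n ] ∑[ v < n ] (L u v * w u v) +_) (∑-comm (λ u v → L u v * w v u)) ⟩
    ∑[ u < n ] ∑[ v < n ] (L u v * w u v) + ∑[ u < n ] ∑[ v < n ] (L v u * w u v)
      ≡⟨ ∑∑-distrib (λ u v → trans (cong (_* w u v) (sym (L-total u v))) (*-distribʳ-+ (w u v) (L u v) (L v u))) ⟨
    adjSum w ∎
    where
    open ≡-Reasoning
    W : Fin n × Fin n → ℕ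
    W (u , v) = w u v + w v u

    L : Fin n → Fin n → ℕ
    L u v = 𝟙 (does ((u <? v) ×-dec (u ~? v)))

    L-total : ∀ u v → L u v + L v u ≡ adj u v
    L-total u v with <-cmp u v
    ... | tri< u<v _ v≮u rewrite dec-true (u <? v) u<v | dec-false (v <? u) v≮u = +-identityʳ _
    ... | tri≈ u≮v refl v≮u rewrite dec-false (u <? v) u≮v | dec-false (u ~? v) (~-irrefl refl) = refl
    ... | tri> u≮v _ v<u rewrite dec-false (u <? v) u≮v | dec-true (v <? u) v<u = adj-sym v u

    ∑∑-distrib : {f g h : Fin n → Fin n → ℕ} → (∀ u v → f u v ≡ g u v + h u v) →
      ∑[ u < n ] ∑[ v < n ] f u v ≡ ∑[ u < n ] ∑[ v < n ] g u v + ∑[ u < n ] ∑[ v < n ] h u v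
    ∑∑-distrib {f} {g} {h} eq = trans
      (sum-cong-≗ λ u → trans (sum-cong-≗ (eq u)) (∑-distrib-+ (g u) (h u)))
      (∑-distrib-+ (λ u → ∑ (g u)) (λ u → ∑ (h u)))

  degree-∑ : ∀ u → degree u ≡ ∑[ v < n ] adj u v
  degree-∑ u = ∣tabulate∣ (λ v → does (u ~? v))

  handshake : adjSum (λ _ _ → 1) ≡ 2 * e G
  handshake = trans (sym (adjSum-edges (λ _ _ → 1))) (trans (∑-const (e G) 2) (*-comm (e G) 2))

  crosses : (Fin n → Bool) → Fin (e G) → Bool
  crosses A i = A (src i) xor A (tgt i)

  boundary : (Fin n → Bool) → EdgeSet G
  boundary A = Vec.tabulate (crosses A)

  -- Of the two orientations of a crossing edge only the one pointing out of `A` has weight 1, so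
  -- each crossing edge counts once.
  cutSize : (Fin n → Bool) → ℕ
  cutSize A = adjSum (λ u v → 𝟙 (A u) * 𝟙 (not (A v)))

  ∣boundary∣ : ∀ A → ∣ boundary A ∣ ≡ cutSize A
  ∣boundary∣ A = trans (∣tabulate∣ (crosses A)) (trans (sum-cong-≗ λ i → split (A (src i)) (A (tgt i))) (adjSum-edges _))
    where
    split : ∀ x y → 𝟙 (x xor y) ≡ 𝟙 x * 𝟙 (not y) + 𝟙 y * 𝟙 (not x)
    split true  true  = refl
    split true  false = refl
    split false true  = refl
    split false false = refl

  edge-∈ : ∀ i → src i < tgt i × src i ~ tgt i
  edge-∈ i = proj₂ (∈-filter⁻ _ {xs = cartesianProduct (allFin n) (allFin n)} (∈-lookup {xs = edges} i))

  edges-unique : Unique edges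
  edges-unique = filter⁺ _ (cartesianProduct⁺ (allFin⁺ n) (allFin⁺ n))

  edge-index : ∀ {u v} → u ~ v → ∃ λ i → i joins u and v
  edge-index {u} {v} p with <-cmp u v
  ... | tri≈ _ refl _ = contradiction p (~-irrefl refl)
  ... | tri< u<v _ _ = index u∈ , inj₁ (sym (lookup-index u∈))
    where
    u∈ : (u , v) ∈ edges
    u∈ = ∈-filter⁺ _ (∈-cartesianProduct⁺ (∈-allFin u) (∈-allFin v)) (u<v , p)
  ... | tri> _ _ v<u = index v∈ , inj₂ (sym (lookup-index v∈))
    where
    v∈ : (v , u) ∈ edges
    v∈ = ∈-filter⁺ _ (∈-cartesianProduct⁺ (∈-allFin v) (∈-allFin u)) (v<u , ~-sym p)

  boundary⇒≢ : ∀ A {u v} → Contains (boundary A) u v → A u ≢ A v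
  boundary⇒≢ A (i , i∈ , inj₁ eq) = subst (λ (x , y) → A x ≢ A y) eq (xor-≡ (∈-tabulate⁻ _ i∈))
  boundary⇒≢ A (i , i∈ , inj₂ eq) = ≢-sym (subst (λ (x , y) → A x ≢ A y) eq (xor-≡ (∈-tabulate⁻ _ i∈)))

  ≢⇒boundary : ∀ A {u v} → u ~ v → A u ≢ A v → Contains (boundary A) u v
  ≢⇒boundary A u~v A≢ with edge-index u~v
  ... | i , inj₁ eq = i , ∈-tabulate⁺ _ (xor-≢ (subst (λ (x , y) → A x ≢ A y) (sym eq) A≢)) , inj₁ eq
  ... | i , inj₂ eq = i , ∈-tabulate⁺ _ (xor-≢ (subst (λ (x , y) → A x ≢ A y) (sym eq) (≢-sym A≢))) , inj₂ eq

  -- A step along which `A` changes would be an edge of the boundary, and these are removed. Hence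
  -- `A` is constant along every walk.
  boundary-separates : ∀ A {u v} → Star (Graph._~_ (G - boundary A)) u v → A u ≡ A v
  boundary-separates A ε = refl
  boundary-separates A {u} (_◅_ {j = w} (u~w , ¬c) s) =
    trans (decidable-stable (A u ≟ᵇ A w) (λ A≢ → ¬c (≢⇒boundary A u~w A≢))) (boundary-separates A s)

  boundary-cuts : ∀ A {u v} → A u ≡ true → A v ≡ false → IsEdgeCut G (boundary A)
  boundary-cuts A {u} {v} Au Av conn with () ← trans (sym Au) (trans (boundary-separates A (conn u v)) Av)

  -- The edge from `x` to a neighbour on its own side survives the removal, so the component of `x`
  -- contains both ends.
  boundary-restricted : ∀ A {u v} → A u ≡ true → A v ≡ false →
    (∀ x → ∃ λ y → x ~ y × A x ≡ A y) → IsRestrictedEdgeCut G (boundary A)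
  boundary-restricted A Au Av nbr = boundary-cuts A Au Av , λ x →
    let y , x~y , A≡ = nbr x
        R? = Graph.reachable? (G - boundary A) x
    in subst (2 ≤_) (sym (∣tabulate∣ (λ z → does (R? z))))
         (two-elements (λ z → does (R? z)) (λ x≡y → ~-irrefl x≡y x~y)
           (dec-true (R? x) ε) (dec-true (R? y) ((x~y , λ c → boundary⇒≢ A c A≡) ◅ ε)))

  module _ (S : EdgeSet G) where

    reaches : Fin n → Fin n → Bool
    reaches u v = does (Graph.reachable? (G - S) u v)

    -- An edge outside `S` has both ends reachable from `u` or neither. So the boundary of the
    -- component of `u` is contained in `S`.
    cutSize-component : ∀ u → cutSize (reaches u) ≤ ∣ S ∣
    cutSize-component u = subst (_≤ ∣ S ∣) (∣boundary∣ (reaches u)) (p⊆q⇒∣p∣≤∣q∣ ⊆S)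
      where
      R? = Graph.reachable? (G - S) u

      stable : ∀ {v w} → v ~ w → ¬ Contains S v w → reaches u v ≡ reaches u w
      stable {v} {w} v~w ¬c = does-⇔ (mk⇔
        (λ r → r ◅◅ (v~w , ¬c) ◅ ε)
        (λ r → r ◅◅ (~-sym v~w , ¬c ∘ contains-sym S) ◅ ε)) (R? v) (R? w)

      ⊆S : ∀ {i} → i ∈ₛ boundary (reaches u) → i ∈ₛ S
      ⊆S {i} i∈ = decidable-stable (i ∈? S) λ i∉S →
        xor-≡ (∈-tabulate⁻ _ i∈) (stable (proj₂ (edge-∈ i)) (only i∉S))
        where
        -- Every edge is listed as an increasing pair, without repetition. A position `j` joining
        -- the ends of edge `i` is therefore `i` itself, or else would hold a decreasing pair.
        only : ¬ (i ∈ₛ S) → ¬ Contains S (src i) (tgt i)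
        only i∉S (j , j∈S , inj₁ eq) = i∉S (subst (_∈ₛ S) (lookup-injective edges-unique j i eq) j∈S)
        only i∉S (j , j∈S , inj₂ eq) = <-asym (proj₁ (edge-∈ i)) (subst (λ (x , y) → x < y) eq (proj₁ (edge-∈ j)))

    disconnected : IsEdgeCut G S → ∃₂ λ u v → ¬ Star (Graph._~_ (G - S)) u v
    disconnected ¬conn with ¬∀⟶∃¬ n _ (λ u → all? (Graph.reachable? (G - S) u)) ¬conn
    ... | u , ¬u with ¬∀⟶∃¬ n _ (Graph.reachable? (G - S) u) ¬u
    ... | v , ¬r = u , v , ¬r

    edgeCut-component : IsEdgeCut G S → ∃ λ A → cutSize A ≤ ∣ S ∣ × (∃ λ u → A u ≡ true) × (∃ λ v → A v ≡ false)
    edgeCut-component cut with disconnected cut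
    ... | u , v , ¬r = reaches u , cutSize-component u ,
      (u , dec-true (Graph.reachable? (G - S) u u) ε) , (v , dec-false (Graph.reachable? (G - S) u v) ¬r)

    -- Take the component of `u` for `A`. The complement contains the component of a vertex `v` not
    -- reachable from `u`, and both components have at least two vertices.
    restrictedEdgeCut-component : IsRestrictedEdgeCut G S →
      ∃ λ A → cutSize A ≤ ∣ S ∣ × 2 ≤ ∑[ u < n ] 𝟙 (A u) × 2 ≤ ∑[ u < n ] 𝟙 (not (A u))
    restrictedEdgeCut-component (cut , big) with disconnected cut
    ... | u , v , ¬r = reaches u , cutSize-component u ,
      subst (2 ≤_) (∣tabulate∣ (reaches u)) (big u) ,
      ≤-trans (subst (2 ≤_) (∣tabulate∣ (reaches v)) (big v)) (∑-mono-≤ disjoint)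
      where
      disjoint : ∀ w → 𝟙 (reaches v w) ≤ 𝟙 (not (reaches u w))
      disjoint w = 𝟙-disjoint (Graph.reachable? (G - S) v w) (Graph.reachable? (G - S) u w)
        λ p q → ¬r (q ◅◅ reverse (Graph.~-sym (G - S)) p)

  -- The boundary of the single vertex `u` is an edge cut, because `v` lies on the other side. So
  -- cuts exist and the default 0 in `edgeConnectivity` is not taken.
  edgeConnectivity-spec : {u v : Fin n} → u ≢ v →
    (∃ λ S → IsEdgeCut G S × ∣ S ∣ ≡ edgeConnectivity G) × (∀ S → IsEdgeCut G S → edgeConnectivity G ≤ ∣ S ∣)
  edgeConnectivity-spec {u} {v} u≢v =
    let l , eq , (S₀ , cut , ∣S₀∣≡l) , lower =
          minimum-size-spec (isEdgeCut? G) (boundary-cuts (λ x → does (x ≟ u)) {u} {v}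
            (dec-true (u ≟ u) refl) (dec-false (v ≟ u) (≢-sym u≢v)))
        λ≡l = cong (fromMaybe 0) eq
    in (S₀ , cut , trans ∣S₀∣≡l (sym λ≡l)) , λ S cut → ≤-trans (≤-reflexive λ≡l) (lower S cut)

  edgeConnectivity-attained : {u v : Fin n} → u ≢ v →
    ∃ λ A → cutSize A ≤ edgeConnectivity G × (∃ λ u → A u ≡ true) × (∃ λ v → A v ≡ false)
  edgeConnectivity-attained u≢v =
    let (S , cut , eq) , _ = edgeConnectivity-spec u≢v
        A , A≤S , rest = edgeCut-component S cut
    in A , ≤-trans A≤S (≤-reflexive eq) , rest

  edgeConnectivity≤cutSize : ∀ A {u v} → A u ≡ true → A v ≡ false → edgeConnectivity G ≤ cutSize A
  edgeConnectivity≤cutSize A {u} {v} Au Av =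
    subst (edgeConnectivity G ≤_) (∣boundary∣ A)
      (proj₂ (edgeConnectivity-spec {u} {v} u≢v) (boundary A) (boundary-cuts A Au Av))
    where
    u≢v : u ≢ v
    u≢v refl with () ← trans (sym Au) Av

  -- The vertex supplied makes the list of degrees nonempty, so the default 0 in `δ` is not taken.
  δ-spec : Fin n → (∃ λ x → degree x ≡ δ G) × (∀ x → δ G ≤ degree x)
  δ-spec u =
    let d , eq , d∈ , lower = minimum-spec (∈-map⁺ degree (∈-allFin u))
        x , _ , d≡ = ∈-map⁻ degree d∈
        δ≡d = cong (fromMaybe 0) eq
    in (x , trans (sym d≡) (sym δ≡d)) , λ y → ≤-trans (≤-reflexive δ≡d) (lower (∈-map⁺ degree (∈-allFin y)))

  neighbour : Connected G → ∀ {u v} → u ≢ v → ∃ λ w → u ~ w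
  neighbour conn {u} {v} u≢v with conn u v
  ... | ε     = contradiction refl u≢v
  ... | p ◅ _ = _ , p

  degree-positive : ∀ {u w} → u ~ w → 1 ≤ degree u
  degree-positive {u} {w} u~w = begin
    1                    ≡⟨ cong 𝟙 (dec-true (u ~? w) u~w) ⟨
    adj u w              ≤⟨ ∑-single (adj u) w ⟩
    ∑[ v < n ] adj u v   ≡⟨ degree-∑ u ⟨
    degree u             ∎
    where open ≤-Reasoning

-- Lower bounds

-- This is `(p - 1)(q - 1) ≥ 0`, rearranged.
m+n≤1+m*n : ∀ {p q} → 1 ≤ p → 1 ≤ q → p + q ≤ suc (p * q)
m+n≤1+m*n {suc p} {suc q} _ _ = s≤s (begin
  p + suc q        ≡⟨ +-comm p (suc q) ⟩
  suc q + p        ≤⟨ +-monoʳ-≤ (suc q) (m≤m*n p (suc q)) ⟩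
  suc q + p * suc q ∎)
  where open ≤-Reasoning

positive-product : ∀ {p q} → 1 ≤ p → 1 ≤ q → p + q ≡ suc k → k ≤ p * q
positive-product {p = p} {q} 1≤p 1≤q eq = s≤s⁻¹ (subst (_≤ suc (p * q)) eq (m+n≤1+m*n 1≤p 1≤q))

positive-cross : ∀ {p q p′ q′} → 1 ≤ p → 1 ≤ q → 1 ≤ p′ → 1 ≤ q′ →
  p + q ≡ suc k → p′ + q′ ≡ suc k → k + k ≤ p * q′ + p′ * q
positive-cross {k} {p} {q} {p′} {q′} 1≤p 1≤q 1≤p′ 1≤q′ eq eq′ = +-cancelˡ-≤ 2 _ _ (begin
  2 + (k + k)                       ≡⟨ cong suc (+-suc k k) ⟨
  suc k + suc k                     ≡⟨ cong₂ _+_ eq eq′ ⟨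
  (p + q) + (p′ + q′)               ≡⟨ swap p q p′ q′ ⟩
  (p + q′) + (p′ + q)               ≤⟨ +-mono-≤ (m+n≤1+m*n 1≤p 1≤q′) (m+n≤1+m*n 1≤p′ 1≤q) ⟩
  suc (p * q′) + suc (p′ * q)       ≡⟨ cong suc (+-suc (p * q′) (p′ * q)) ⟩
  2 + (p * q′ + p′ * q)             ∎)
  where
  open ≤-Reasoning
  swap : ∀ a b c d → (a + b) + (c + d) ≡ (a + d) + (c + b)
  swap = solve-∀

-- With `t = p′ - p` and `q = t + q′`, the right side exceeds `n * t` by exactly `2 * p * q′`.
difference-cross-≤ : ∀ {p q p′ q′} → p ≤ p′ → p + q ≡ n → p′ + q′ ≡ n →
  n * (p ∸ p′) + n * (p′ ∸ p) ≤ p * q′ + p′ * q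
difference-cross-≤ {n} {p} {q} {p′} {q′} p≤p′ eq eq′ = begin
  n * (p ∸ p′) + n * t              ≡⟨ cong (λ r → n * r + n * t) (m≤n⇒m∸n≡0 p≤p′) ⟩
  n * 0 + n * t                     ≡⟨ cong (_+ n * t) (*-zeroʳ n) ⟩
  n * t                             ≡⟨ cong (_* t) (trans (sym eq) (cong (p +_) q≡)) ⟩
  (p + (t + q′)) * t                ≤⟨ m≤m+n _ (p * q′ + p * q′) ⟩
  (p + (t + q′)) * t + (p * q′ + p * q′)  ≡⟨ expand p t q′ ⟩
  p * q′ + (p + t) * (t + q′)       ≡⟨ cong₂ (λ r s → p * q′ + r * s) (m+[n∸m]≡n p≤p′) (sym q≡) ⟩
  p * q′ + p′ * q                   ∎
  where
  open ≤-Reasoning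
  t : ℕ
  t = p′ ∸ p

  q≡ : q ≡ t + q′
  q≡ = +-cancelˡ-≡ p _ _ (trans (trans eq (sym eq′)) (trans (cong (_+ q′) (sym (m+[n∸m]≡n p≤p′))) (+-assoc p t q′)))

  expand : ∀ p t q′ → (p + (t + q′)) * t + (p * q′ + p * q′) ≡ p * q′ + (p + t) * (t + q′)
  expand = solve-∀

difference-cross : ∀ {p q p′ q′} → p + q ≡ n → p′ + q′ ≡ n → n * (p ∸ p′) + n * (p′ ∸ p) ≤ p * q′ + p′ * q
difference-cross {n} {p} {q} {p′} {q′} eq eq′ with ≤-total p p′
... | inj₁ p≤p′ = difference-cross-≤ p≤p′ eq eq′
... | inj₂ p′≤p = subst₂ _≤_ (+-comm (n * (p′ ∸ p)) _) (+-comm (p′ * q) _) (difference-cross-≤ p′≤p eq′ eq)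

-- The thresholds counted are those with `q ≤ t < p`. Some of them may fail to lie below `n`, whence
-- an inequality.
threshold-count : ∀ n p q → ∑[ t < n ] (𝟙 (toℕ t <ᵇ p) * 𝟙 (not (toℕ t <ᵇ q))) ≤ p ∸ q
threshold-count zero    p       q       = z≤n
threshold-count (suc n) zero    q       = subst (_≤ 0 ∸ q) (sym (sum-replicate-zero n)) z≤n
threshold-count (suc n) (suc p) zero    = s≤s (threshold-count n p zero)
threshold-count (suc n) (suc p) (suc q) = threshold-count n p q

positive? : ℕ → Bool
positive? p = 0 <ᵇ p

positive-true : ∀ {p} → 1 ≤ p → positive? p ≡ true
positive-true (s≤s _) = refl

-- Boundary estimates from fibre weights

module Weights (G : Graph m) where

  open Graph G hiding (Connected; connected?; component; δ; e; EdgeSet)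
  open Cuts G

  -- The number of edges of G ⊠ K n leaving a vertex set that has p x
  -- vertices in the fibre over x and misses q x of them.
  blowupCut : (p q : Fin m → ℕ) → ℕ
  blowupCut p q = ∑[ x < m ] (p x * q x) + adjSum (λ x y → p x * q y)

  -- Complementing a vertex set exchanges `p` and `q` and keeps its boundary.
  blowupCut-sym : ∀ p q → blowupCut p q ≡ blowupCut q p
  blowupCut-sym p q = cong₂ _+_ (sum-cong-≗ λ x → *-comm (p x) (q x))
    (trans (sum-cong-≗ λ x → sum-cong-≗ λ y → cong (adj x y *_) (*-comm (p x) (q y))) (adjSum-transpose (λ x y → q x * p y)))

  ∑-adjSum : ∀ n (w : Fin n → Fin m → Fin m → ℕ) →
    ∑[ t < n ] adjSum (w t) ≡ adjSum (λ x y → ∑[ t < n ] w t x y)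
  ∑-adjSum n w = trans (∑-comm (λ t x → ∑[ y < m ] (adj x y * w t x y)))
    (sum-cong-≗ λ x → trans (∑-comm (λ t y → adj x y * w t x y))
      (sum-cong-≗ λ y → sym (*-distribˡ-sum (adj x y) (λ t → w t x y))))

  module _ (p q : Fin m → ℕ) {n : ℕ} (p+q : ∀ x → p x + q x ≡ n) where

    -- Every level set of p is a nontrivial vertex set of G.
    blowupCut≥n²λ : ∀ {u v} → p u ≡ n → p v ≡ 0 → n * (n * edgeConnectivity G) ≤ blowupCut p q
    blowupCut≥n²λ {u} {v} pu pv = begin
      n * (n * edgeConnectivity G)
        ≡⟨ cong (n *_) (∑-const n _) ⟨
      n * (∑[ t < n ] edgeConnectivity G)
        ≤⟨ *-monoʳ-≤ n (∑-mono-≤ λ t → edgeConnectivity≤cutSize (level t) {u} {v} (level-u t) (level-v t)) ⟩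
      n * (∑[ t < n ] cutSize (level t))
        ≡⟨ cong (n *_) (∑-adjSum n (λ t x y → 𝟙 (level t x) * 𝟙 (not (level t y)))) ⟩
      n * adjSum (λ x y → ∑[ t < n ] (𝟙 (level t x) * 𝟙 (not (level t y))))
        ≤⟨ *-monoʳ-≤ n (adjSum-mono-≤ λ {x} {y} _ → threshold-count n (p x) (p y)) ⟩
      n * adjSum (λ x y → p x ∸ p y)
        ≡⟨ adjSum-const n _ ⟨
      adjSum (λ x y → n * (p x ∸ p y))
        ≤⟨ adjSum-mono-sym (λ {x} {y} _ → difference-cross {p = p x} {p′ = p y} (p+q x) (p+q y)) ⟩
      adjSum (λ x y → p x * q y)
        ≤⟨ m≤n+m _ _ ⟩
      blowupCut p q ∎
      where
      open ≤-Reasoning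
      level : Fin n → Fin m → Bool
      level t x = toℕ t <ᵇ p x

      level-u : ∀ t → level t u ≡ true
      level-u t = trans (cong (toℕ t <ᵇ_) pu) (dec-true (toℕ t ℕ.<? n) (toℕ<n t))

      level-v : ∀ t → level t v ≡ false
      level-v t = cong (toℕ t <ᵇ_) pv

  module _ (p q : Fin m → ℕ) {k : ℕ} (p+q : ∀ x → p x + q x ≡ suc k) (q≥1 : ∀ x → 1 ≤ q x) where

    outside-degree : Fin m → ℕ
    outside-degree x = ∑[ y < m ] (adj x y * 𝟙 (not (positive? (p y))))

    -- The share of the boundary credited to a vertex of the support: `k` for its own fibre, `k` for
    -- each neighbour, and one more for each neighbour outside the support, whose fibre is missed in
    -- all `suc k` vertices.
    supportWeight : Fin m → ℕ
    supportWeight x = 𝟙 (positive? (p x)) * (k * (1 + degree x) + outside-degree x)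

    blowupCut≥support : ∑ supportWeight ≤ blowupCut p q
    blowupCut≥support = begin
      ∑[ x < m ] (s x * (k * (1 + degree x) + outside-degree x))
        ≡⟨ sum-cong-≗ expand ⟩
      ∑[ x < m ] (s x * k + ∑[ y < m ] (adj x y * (s x * (k + z y))))
        ≡⟨ ∑-distrib-+ (λ x → s x * k) _ ⟩
      ∑[ x < m ] (s x * k) + adjSum (λ x y → s x * (k + z y))
        -- Between two support vertices one orientation may give less than `k`, for instance 1 when
        -- `p x` and `q y` are both 1. Only the two orientations together are sure to give `2 * k`.
        ≤⟨ +-mono-≤ (∑-mono-≤ λ x → vertex (p x) (q≥1 x) (p+q x))
                    (adjSum-mono-sym λ {x} {y} _ → pair (p x) (p y) (q≥1 x) (q≥1 y) (p+q x) (p+q y)) ⟩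
      blowupCut p q ∎
      where
      open ≤-Reasoning
      s z : Fin m → ℕ
      s x = 𝟙 (positive? (p x))
      z x = 𝟙 (not (positive? (p x)))

      expand : ∀ x → s x * (k * (1 + degree x) + outside-degree x) ≡ s x * k + ∑[ y < m ] (adj x y * (s x * (k + z y)))
      expand x = begin-equality
        s x * (k * (1 + degree x) + outside-degree x)
          ≡⟨ cong (λ d → s x * (k * (1 + d) + outside-degree x)) (degree-∑ x) ⟩
        s x * (k * (1 + ∑ (adj x)) + outside-degree x)
          ≡⟨ distribute (s x) k (∑ (adj x)) (outside-degree x) ⟩
        s x * k + (s x * k * ∑ (adj x) + s x * outside-degree x)
          ≡⟨ cong (s x * k +_) (cong₂ _+_ (*-distribˡ-sum (s x * k) (adj x)) (*-distribˡ-sum (s x) (λ y → adj x y * z y))) ⟩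
        s x * k + (∑[ y < m ] (s x * k * adj x y) + ∑[ y < m ] (s x * (adj x y * z y)))
          ≡⟨ cong (s x * k +_) (∑-distrib-+ (λ y → s x * k * adj x y) _) ⟨
        s x * k + ∑[ y < m ] (s x * k * adj x y + s x * (adj x y * z y))
          ≡⟨ cong (s x * k +_) (sum-cong-≗ λ y → collect (s x) k (adj x y) (z y)) ⟩
        s x * k + ∑[ y < m ] (adj x y * (s x * (k + z y))) ∎
        where
        distribute : ∀ s k d o → s * (k * (1 + d) + o) ≡ s * k + (s * k * d + s * o)
        distribute = solve-∀
        collect : ∀ s k a z → s * k * a + s * (a * z) ≡ a * (s * (k + z))
        collect = solve-∀

      vertex : ∀ p {q} → 1 ≤ q → p + q ≡ suc k → 𝟙 (positive? p) * k ≤ p * q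
      vertex zero    _   _  = z≤n
      vertex (suc p) 1≤q eq = ≤-trans (≤-reflexive (*-identityˡ k)) (positive-product {p = suc p} (s≤s z≤n) 1≤q eq)

      pair : ∀ p p′ {q q′} → 1 ≤ q → 1 ≤ q′ → p + q ≡ suc k → p′ + q′ ≡ suc k →
        𝟙 (positive? p) * (k + 𝟙 (not (positive? p′))) + 𝟙 (positive? p′) * (k + 𝟙 (not (positive? p)))
          ≤ p * q′ + p′ * q
      pair zero zero _ _ _ _ = z≤n
      -- One end is outside the support, so its `q` is `suc k`; this supplies the extra 1 beyond
      -- `k`.
      pair zero (suc p′) {q} _ _ refl _ = begin
        k + 1 + 0          ≡⟨ +-identityʳ (k + 1) ⟩
        k + 1              ≡⟨ +-comm k 1 ⟩
        suc k              ≤⟨ m≤m+n (suc k) (p′ * suc k) ⟩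
        suc k + p′ * suc k ∎
      pair (suc p) zero {q} {q′} _ _ _ refl = begin
        k + 1 + 0 + 0          ≡⟨ trans (+-identityʳ _) (+-identityʳ (k + 1)) ⟩
        k + 1                  ≡⟨ +-comm k 1 ⟩
        suc k                  ≤⟨ m≤m+n (suc k) (p * suc k) ⟩
        suc k + p * suc k      ≡⟨ +-identityʳ _ ⟨
        suc k + p * suc k + 0  ∎
      pair (suc p) (suc p′) {q} {q′} 1≤q 1≤q′ eq eq′ = begin
        k + 0 + 0 + (k + 0 + 0)   ≡⟨ simplify k ⟩
        k + k                     ≤⟨ positive-cross {p = suc p} {p′ = suc p′} (s≤s z≤n) 1≤q (s≤s z≤n) 1≤q′ eq eq′ ⟩
        suc p * q′ + suc p′ * q   ∎
        where
        simplify : ∀ k → k + 0 + 0 + (k + 0 + 0) ≡ k + k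
        simplify = solve-∀

    -- The cases are a support of one, two, or at least three vertices. The 4 is kept on the right
    -- to avoid truncated subtraction.
    support-bound : 2 ≤ k → (∀ x → 1 ≤ degree x) → 2 ≤ ∑ p →
      2 * suc k * δ G + 2 * suc k ≤ 4 + blowupCut p q
    support-bound 2≤k deg≥1 ∑p≥2 with any? (λ u → 1 ≤? p u)
    ... | no none = contradiction ∑p≥2 (<⇒≱ (≤-<-trans (∑-mono-≤ (λ x → s≤s⁻¹ (≰⇒> λ 1≤ → none (x , 1≤))))
                      (subst (ℕ._< 2) (sym (sum-replicate-zero m)) (s≤s z≤n))))
    ... | yes (u , pu) with any? (λ v → ¬? (v ≟ u) ×-dec (1 ≤? p v))
    -- The whole set lies in the fibre over `u`, so `p u` is at least 2. The fibres over the
    -- neighbours of `u` are missed entirely, and each contributes `p u * suc k` edges.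
    ...   | no alone = begin
      2 * suc k * δ G + 2 * suc k
        ≤⟨ single (p u) (q u) pu≥2 (q≥1 u) (p+q u) (deg≥1 u) (proj₂ (δ-spec u) u) ⟩
      4 + (p u * q u + p u * suc k * degree u)
        ≡⟨ cong (λ d → 4 + (p u * q u + p u * suc k * d)) (degree-∑ u) ⟩
      4 + (p u * q u + p u * suc k * ∑ (adj u))
        ≡⟨ cong (λ r → 4 + (p u * q u + r)) (*-distribˡ-sum (p u * suc k) (adj u)) ⟩
      4 + (p u * q u + ∑[ y < m ] (p u * suc k * adj u y))
        ≤⟨ +-monoʳ-≤ 4 (+-mono-≤ (∑-single (λ x → p x * q x) u)
             (≤-trans (∑-mono-≤ neighbours) (∑-single (λ x → ∑[ y < m ] (adj x y * (p x * q y))) u))) ⟩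
      4 + blowupCut p q ∎
      where
      open ≤-Reasoning
      off : ∀ {x} → x ≢ u → p x ≡ 0
      off {x} x≢u = n<1⇒n≡0 (≰⇒> λ 1≤ → alone (x , x≢u , 1≤))

      pu≥2 : 2 ≤ p u
      pu≥2 = begin
        2 ≤⟨ ∑p≥2 ⟩
        ∑ p ≤⟨ ∑-mono-≤ concentrated ⟩
        ∑[ x < m ] (𝟙 (does (x ≟ u)) * p x) ≡⟨ ∑-indicator u p ⟩
        p u ∎
        where
        concentrated : ∀ x → p x ≤ 𝟙 (does (x ≟ u)) * p x
        concentrated x with x ≟ u
        ... | yes _   = ≤-reflexive (sym (*-identityˡ (p x)))
        ... | no x≢u = ≤-reflexive (off x≢u)

      neighbours : ∀ y → p u * suc k * adj u y ≤ adj u y * (p u * q y)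
      neighbours y with u ~? y
      ... | no _    = ≤-reflexive (*-zeroʳ (p u * suc k))
      ... | yes u~y = ≤-reflexive (trans (*-comm _ 1) (cong (λ r → 1 * (p u * r))
              (trans (sym (p+q y)) (cong (_+ q y) (off λ y≡u → ~-irrefl (sym y≡u) u~y)))))

      single : ∀ a b {d δ} → 2 ≤ a → 1 ≤ b → a + b ≡ suc k → 1 ≤ d → δ ≤ d →
        2 * suc k * δ + 2 * suc k ≤ 4 + (a * b + a * suc k * d)
      single (suc zero) _ (s≤s ())
      single (suc (suc a)) (suc b) {d} {δ} _ _ eq 1≤d δ≤d = begin
        2 * suc k * δ + 2 * suc k
          ≤⟨ +-monoˡ-≤ (2 * suc k) (*-monoʳ-≤ (2 * suc k) δ≤d) ⟩
        2 * suc k * d + 2 * suc k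
          ≡⟨ cong (λ r → 2 * suc k * d + 2 * r) eq ⟨
        2 * suc k * d + 2 * (2 + a + suc b)
          -- Of the `2 * a` to be covered, one `a` comes from `(2 + a) * suc b` and the other from
          -- `a * suc k * d`, which uses `1 ≤ d`.
          ≡⟨ regroup (2 * suc k * d) a b ⟩
        2 * suc k * d + (6 + 2 * b + a) + a * 1 * 1
          ≤⟨ +-mono-≤ (m≤m+n (2 * suc k * d + (6 + 2 * b + a)) (a * b)) (*-mono-≤ (*-monoʳ-≤ a {1} {suc k} (s≤s z≤n)) 1≤d) ⟩
        2 * suc k * d + (6 + 2 * b + a) + a * b + a * suc k * d
          ≡⟨ recombine (suc k) d a b ⟩
        4 + ((2 + a) * suc b + (2 + a) * suc k * d) ∎
        where
        regroup : ∀ c a b → c + 2 * (2 + a + suc b) ≡ c + (6 + 2 * b + a) + a * 1 * 1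
        regroup = solve-∀
        recombine : ∀ n d a b → 2 * n * d + (6 + 2 * b + a) + a * b + a * n * d ≡ 4 + ((2 + a) * suc b + (2 + a) * n * d)
        recombine = solve-∀
    ...   | yes (v , v≢u , pv) with any? (λ w → ¬? (w ≟ u) ×-dec ¬? (w ≟ v) ×-dec (1 ≤? p w))
    ...     | yes (w , w≢u , w≢v , pw) = begin
      2 * suc k * δ G + 2 * suc k
        ≡⟨ factor k (δ G) ⟩
      (2 + 2 * k) * (1 + δ G)
        -- Three shares of `k` reach `2 + 2 * k` exactly because `2 ≤ k`.
        ≤⟨ *-monoˡ-≤ (1 + δ G) (+-monoˡ-≤ (2 * k) 2≤k) ⟩
      (k + 2 * k) * (1 + δ G)
        ≡⟨ thrice k (1 + δ G) ⟩
      k * (1 + δ G) + k * (1 + δ G) + k * (1 + δ G)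
        ≤⟨ +-mono-≤ (+-mono-≤ (share pu) (share pv)) (share pw) ⟩
      supportWeight u + supportWeight v + supportWeight w
        ≤⟨ ∑-three supportWeight (≢-sym v≢u) w≢u w≢v ⟩
      ∑ supportWeight
        ≤⟨ blowupCut≥support ⟩
      blowupCut p q
        ≤⟨ m≤n+m _ 4 ⟩
      4 + blowupCut p q ∎
      where
      open ≤-Reasoning
      share : ∀ {x} → 1 ≤ p x → k * (1 + δ G) ≤ supportWeight x
      share {x} px = begin
        k * (1 + δ G)                                ≤⟨ *-monoʳ-≤ k (s≤s (proj₂ (δ-spec u) x)) ⟩
        k * (1 + degree x)                           ≤⟨ m≤m+n _ (outside-degree x) ⟩
        k * (1 + degree x) + outside-degree x        ≡⟨ *-identityˡ _ ⟨
        1 * (k * (1 + degree x) + outside-degree x)  ≡⟨ cong (λ b → 𝟙 b * (k * (1 + degree x) + outside-degree x)) (positive-true px) ⟨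
        supportWeight x                                          ∎

      factor : ∀ k d → 2 * suc k * d + 2 * suc k ≡ (2 + 2 * k) * (1 + d)
      factor = solve-∀
      thrice : ∀ k d → (k + 2 * k) * d ≡ k * d + k * d + k * d
      thrice = solve-∀
    ...     | no noMore = begin
      2 * suc k * δ G + 2 * suc k
        -- The 4 splits as 2 + 1 + 1: `2 * suc k` exceeds `2 * k` by 2, and each of the two support
        -- vertices may lose 1 because the other is its neighbour.
        ≡⟨ regroup k (δ G) ⟩
      2 + ((k * (1 + δ G) + δ G) + (k * (1 + δ G) + δ G))
        ≤⟨ +-monoʳ-≤ 2 (+-mono-≤ (share pu (λ _ y≢u y≢v 1≤ → noMore (_ , y≢u , y≢v , 1≤)))
                                 (share pv (λ _ y≢v y≢u 1≤ → noMore (_ , y≢u , y≢v , 1≤)))) ⟩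
      2 + ((1 + supportWeight u) + (1 + supportWeight v))
        ≡⟨ shift (supportWeight u) (supportWeight v) ⟩
      4 + (supportWeight u + supportWeight v)
        ≤⟨ +-monoʳ-≤ 4 (∑-two supportWeight (≢-sym v≢u)) ⟩
      4 + ∑ supportWeight
        ≤⟨ +-monoʳ-≤ 4 blowupCut≥support ⟩
      4 + blowupCut p q ∎
      where
      open ≤-Reasoning
      share : ∀ {x x′} → 1 ≤ p x → (∀ y → y ≢ x → y ≢ x′ → ¬ (1 ≤ p y)) → k * (1 + δ G) + δ G ≤ 1 + supportWeight x
      share {x} {x′} px none = begin
        k * (1 + δ G) + δ G
          ≤⟨ +-mono-≤ (*-monoʳ-≤ k (s≤s (proj₂ (δ-spec u) x))) (proj₂ (δ-spec u) x) ⟩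
        k * (1 + degree x) + degree x
          ≤⟨ +-monoʳ-≤ _ degree≤ ⟩
        k * (1 + degree x) + (1 + outside-degree x)
          ≡⟨ +-suc (k * (1 + degree x)) (outside-degree x) ⟩
        1 + (k * (1 + degree x) + outside-degree x)
          ≡⟨ cong suc (*-identityˡ _) ⟨
        1 + 1 * (k * (1 + degree x) + outside-degree x)
          ≡⟨ cong (λ b → 1 + 𝟙 b * (k * (1 + degree x) + outside-degree x)) (positive-true px) ⟨
        1 + supportWeight x ∎
        where
        -- Among the neighbours of `x` only `x′` can belong to the support, so at most one of them
        -- is absent from `outside-degree x`.
        term : ∀ y → adj x y ≤ 𝟙 (does (y ≟ x′)) * 1 + adj x y * 𝟙 (not (positive? (p y)))
        term y with x ~? y | y ≟ x′
        ... | no _    | _       = z≤n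
        ... | yes _   | yes _   = s≤s z≤n
        ... | yes x~y | no y≢x′ rewrite n<1⇒n≡0 (≰⇒> (none y (λ y≡x → ~-irrefl (sym y≡x) x~y) y≢x′)) = ≤-refl

        degree≤ : degree x ≤ 1 + outside-degree x
        degree≤ = begin
          degree x
            ≡⟨ degree-∑ x ⟩
          ∑ (adj x)
            ≤⟨ ∑-mono-≤ term ⟩
          ∑[ y < m ] (𝟙 (does (y ≟ x′)) * 1 + adj x y * 𝟙 (not (positive? (p y))))
            ≡⟨ ∑-distrib-+ (λ y → 𝟙 (does (y ≟ x′)) * 1) _ ⟩
          ∑[ y < m ] (𝟙 (does (y ≟ x′)) * 1) + outside-degree x
            ≡⟨ cong (_+ outside-degree x) (∑-indicator x′ (λ _ → 1)) ⟩
          1 + outside-degree x ∎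

      regroup : ∀ k d → 2 * suc k * d + 2 * suc k ≡ 2 + ((k * (1 + d) + d) + (k * (1 + d) + d))
      regroup = solve-∀
      shift : ∀ a b → 2 + ((1 + a) + (1 + b)) ≡ 4 + (a + b)
      shift = solve-∀

  blowupCut≥edge-degree : ∀ p q {n} → (∀ x → p x + q x ≡ n) → (∀ x → 1 ≤ q x) → 3 ≤ n →
    (∀ x → 1 ≤ degree x) → 2 ≤ ∑ p → 2 * n * δ G + 2 * n ≤ 4 + blowupCut p q
  blowupCut≥edge-degree p q {suc k} p+q q≥1 (s≤s 2≤k) = support-bound p q p+q q≥1 2≤k

-- The strong product with a complete graph

module Blowup (G : Graph m) (n : ℕ) where

  open Graph G hiding (Connected; connected?; component; δ; e; EdgeSet)
  open Cuts G
  open Weights G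

  private
    module ⊠ = Cuts (G ⊠ K n)

  -- Any two distinct vertices of `K n` are adjacent, so for distinct vertices of the product
  -- adjacency depends only on the base: the first coordinates are equal or adjacent. The two
  -- summands are never both 1, by irreflexivity.
  adj-⊠ : ∀ x i y j → ¬ (x ≡ y × i ≡ j) → ⊠.adj (combine x i) (combine y j) ≡ 𝟙 (does (y ≟ x)) + adj x y
  adj-⊠ x i y j distinct = trans
    (cong₂ (λ u v → 𝟙 (does (strongAdj? G (K n) u v))) (remQuot-combine x i) (remQuot-combine y j))
    (by-cases (y ≟ x) (i ≟ j))
    where
    by-cases : Dec (y ≡ x) → Dec (i ≡ j) →
      𝟙 (does (strongAdj? G (K n) (x , i) (y , j))) ≡ 𝟙 (does (y ≟ x)) + adj x y
    by-cases (yes refl) (yes refl) = contradiction (refl , refl) distinct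
    by-cases (yes refl) (no i≢j)
      rewrite dec-true (strongAdj? G (K n) (x , i) (x , j)) (inj₁ (refl , i≢j))
            | dec-true (x ≟ x) refl | dec-false (x ~? x) (~-irrefl refl) = refl
    by-cases (no y≢x) i≟j
      rewrite dec-false (y ≟ x) y≢x = cong 𝟙 (does-⇔ (mk⇔ to (from i≟j)) (strongAdj? G (K n) (x , i) (y , j)) (x ~? y))
      where
      to : StrongAdj G (K n) (x , i) (y , j) → x ~ y
      to (inj₁ (x≡y , _))       = contradiction (sym x≡y) y≢x
      to (inj₂ (inj₁ (_ , p))) = p
      to (inj₂ (inj₂ (p , _))) = p
      from : Dec (i ≡ j) → x ~ y → StrongAdj G (K n) (x , i) (y , j)
      from (yes i≡j) p = inj₂ (inj₁ (i≡j , p))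
      from (no i≢j)  p = inj₂ (inj₂ (p , i≢j))

  inFibre outFibre : (Fin (m * n) → Bool) → Fin m → ℕ
  inFibre  A x = ∑[ i < n ] 𝟙 (A (combine x i))
  outFibre A x = ∑[ i < n ] 𝟙 (not (A (combine x i)))

  inFibre+outFibre : ∀ A x → inFibre A x + outFibre A x ≡ n
  inFibre+outFibre A x = trans (sym (∑-distrib-+ (λ i → 𝟙 (A (combine x i))) _))
    (trans (sum-cong-≗ λ i → 𝟙-partition (A (combine x i))) (trans (∑-const n 1) (*-identityʳ n)))

  -- The adjacency factor `c x y` does not depend on the positions inside the fibres, so the sum
  -- over those positions factors into `inFibre A x * outFibre A y`. The part of `c` with `y ≟ x`
  -- gives the edges within fibres.
  cutSize-⊠ : ∀ A → ⊠.cutSize A ≡ blowupCut (inFibre A) (outFibre A)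
  cutSize-⊠ A = begin
    ∑[ u < m * n ] ∑[ v < m * n ] (⊠.adj u v * (𝟙 (A u) * 𝟙 (not (A v))))
      ≡⟨ ∑-combine m n (λ u → ∑[ v < m * n ] (⊠.adj u v * (𝟙 (A u) * 𝟙 (not (A v))))) ⟩
    ∑[ x < m ] ∑[ i < n ] ∑[ v < m * n ] (⊠.adj (combine x i) v * (a x i * 𝟙 (not (A v))))
      ≡⟨ (sum-cong-≗ λ x → sum-cong-≗ λ i → trans
           (∑-combine m n (λ v → ⊠.adj (combine x i) v * (a x i * 𝟙 (not (A v)))))
           (sum-cong-≗ λ y → sum-cong-≗ λ j → replace-adj x i y j)) ⟩
    ∑[ x < m ] ∑[ i < n ] ∑[ y < m ] ∑[ j < n ] (c x y * (a x i * b y j))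
      ≡⟨ (sum-cong-≗ λ x → ∑-comm (λ i y → ∑[ j < n ] (c x y * (a x i * b y j)))) ⟩
    ∑[ x < m ] ∑[ y < m ] ∑[ i < n ] ∑[ j < n ] (c x y * (a x i * b y j))
      ≡⟨ (sum-cong-≗ λ x → sum-cong-≗ λ y → factor (c x y) (a x) (b y)) ⟩
    ∑[ x < m ] ∑[ y < m ] (c x y * (inFibre A x * outFibre A y))
      ≡⟨ (sum-cong-≗ λ x → trans (sum-cong-≗ λ y → *-distribʳ-+ (inFibre A x * outFibre A y) (𝟙 (does (y ≟ x))) (adj x y))
           (trans (∑-distrib-+ (λ y → 𝟙 (does (y ≟ x)) * (inFibre A x * outFibre A y)) _)
             (cong (_+ ∑[ y < m ] (adj x y * (inFibre A x * outFibre A y)))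
               (∑-indicator x (λ y → inFibre A x * outFibre A y))))) ⟩
    ∑[ x < m ] (inFibre A x * outFibre A x + ∑[ y < m ] (adj x y * (inFibre A x * outFibre A y)))
      ≡⟨ ∑-distrib-+ (λ x → inFibre A x * outFibre A x) _ ⟩
    blowupCut (inFibre A) (outFibre A) ∎
    where
    open ≡-Reasoning
    a b : Fin m → Fin n → ℕ
    a x i = 𝟙 (A (combine x i))
    b x i = 𝟙 (not (A (combine x i)))

    c : Fin m → Fin m → ℕ
    c x y = 𝟙 (does (y ≟ x)) + adj x y

    replace-adj : ∀ x i y j → ⊠.adj (combine x i) (combine y j) * (a x i * b y j) ≡ c x y * (a x i * b y j)
    replace-adj x i y j = by-cases ((x ≟ y) ×-dec (i ≟ j))
      where
      by-cases : Dec (x ≡ y × i ≡ j) → ⊠.adj (combine x i) (combine y j) * (a x i * b y j) ≡ c x y * (a x i * b y j)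
      -- On the diagonal `adj-⊠` does not apply, but a vertex is never both inside and outside `A`,
      -- so both sides vanish.
      by-cases (yes (refl , refl)) = trans
        (trans (cong (⊠.adj (combine x i) (combine x i) *_) (𝟙-excluded (A (combine x i)))) (*-zeroʳ (⊠.adj (combine x i) (combine x i))))
        (sym (trans (cong (c x x *_) (𝟙-excluded (A (combine x i)))) (*-zeroʳ (c x x))))
      by-cases (no distinct) = cong (_* (a x i * b y j)) (adj-⊠ x i y j distinct)

    factor : ∀ c (a b : Fin n → ℕ) → ∑[ i < n ] ∑[ j < n ] (c * (a i * b j)) ≡ c * (∑ a * ∑ b)
    factor c a b = begin
      ∑[ i < n ] ∑[ j < n ] (c * (a i * b j))
        ≡⟨ (sum-cong-≗ λ i → trans (sym (*-distribˡ-sum c (λ j → a i * b j))) (cong (c *_) (sym (*-distribˡ-sum (a i) b)))) ⟩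
      ∑[ i < n ] (c * (a i * ∑ b))
        ≡⟨ *-distribˡ-sum c (λ i → a i * ∑ b) ⟨
      c * ∑[ i < n ] (a i * ∑ b)
        ≡⟨ cong (c *_) (*-distribʳ-sum (∑ b) a) ⟨
      c * (∑ a * ∑ b) ∎

  lift : (Fin m → Fin n → Bool) → Fin (m * n) → Bool
  lift B u = B (proj₁ (remQuot n u)) (proj₂ (remQuot {m} n u))

  lift-combine : ∀ B x i → lift B (combine x i) ≡ B x i
  lift-combine B x i = cong (λ (y , j) → B y j) (remQuot-combine x i)

  cutSize-lift : ∀ B → ⊠.cutSize (lift B) ≡ blowupCut (λ x → ∑[ i < n ] 𝟙 (B x i)) (λ x → ∑[ i < n ] 𝟙 (not (B x i)))
  cutSize-lift B = trans (cutSize-⊠ (lift B)) (cong₂ _+_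
    (sum-cong-≗ λ x → cong₂ _*_ (in≡ x) (out≡ x))
    (sum-cong-≗ λ x → sum-cong-≗ λ y → cong (adj x y *_) (cong₂ _*_ (in≡ x) (out≡ y))))
    where
    in≡ : ∀ x → inFibre (lift B) x ≡ ∑[ i < n ] 𝟙 (B x i)
    in≡ x = sum-cong-≗ λ i → cong 𝟙 (lift-combine B x i)
    out≡ : ∀ x → outFibre (lift B) x ≡ ∑[ i < n ] 𝟙 (not (B x i))
    out≡ x = sum-cong-≗ λ i → cong (λ b → 𝟙 (not b)) (lift-combine B x i)

  -- Distinct vertices of one fibre are adjacent, so a twin on the same side is the neighbour that
  -- `boundary-restricted` asks for.
  lift-restricted : ∀ B {x i y j} → B x i ≡ true → B y j ≡ false →
    (∀ x i → ∃ λ j → i ≢ j × B x i ≡ B x j) → IsRestrictedEdgeCut (G ⊠ K n) (⊠.boundary (lift B))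
  lift-restricted B {x} {i} {y} {j} Bxi Byj twin =
    ⊠.boundary-restricted (lift B) {combine x i} {combine y j}
      (trans (lift-combine B x i) Bxi) (trans (lift-combine B y j) Byj) nbr
    where
    nbr : ∀ u → ∃ λ v → Graph._~_ (G ⊠ K n) u v × lift B u ≡ lift B v
    nbr u =
      let x , i = remQuot {m} n u
          j , i≢j , eq = twin x i
      in combine x j , subst (StrongAdj G (K n) (x , i)) (sym (remQuot-combine x j)) (inj₁ (refl , i≢j)) ,
         trans eq (sym (lift-combine B x j))

-- A pair of vertices in a fibre and its complement

low : Fin n → Bool
low zero          = true
low (suc zero)    = true
low (suc (suc _)) = false

-- Since `4 ≤ n`, both the two low vertices and the remaining ones number at least two, so every
-- vertex has a partner of its own kind.
twin : 4 ≤ n → (i : Fin n) → ∃ λ j → i ≢ j × low i ≡ low j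
twin (s≤s (s≤s _))             zero                = suc zero , (λ ()) , refl
twin (s≤s (s≤s _))             (suc zero)          = zero , (λ ()) , refl
twin (s≤s (s≤s (s≤s (s≤s _)))) (suc (suc zero))    = suc (suc (suc zero)) , (λ ()) , refl
twin (s≤s (s≤s (s≤s (s≤s _)))) (suc (suc (suc _))) = suc (suc zero) , (λ ()) , refl

low-true : 4 ≤ n → ∃ λ (i : Fin n) → low i ≡ true
low-true (s≤s _) = zero , refl

low-false : 4 ≤ n → ∃ λ (i : Fin n) → low i ≡ false
low-false (s≤s (s≤s (s≤s _))) = suc (suc zero) , refl

∑-low : 4 ≤ n → ∑[ i < n ] 𝟙 (low i) ≡ 2
∑-low {suc (suc n)} (s≤s (s≤s _)) = cong (2 +_) (sum-replicate-zero n)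

∑-not-low : 4 ≤ n → ∑[ i < n ] 𝟙 (not (low i)) + 2 ≡ n
∑-not-low {suc (suc n)} (s≤s (s≤s _)) =
  trans (cong (_+ 2) (trans (∑-const n 1) (*-identityʳ n))) (+-comm n 2)

other : 2 ≤ m → (u : Fin m) → ∃ λ v → u ≢ v
other (s≤s (s≤s _)) zero    = suc zero , λ ()
other (s≤s (s≤s _)) (suc _) = zero , λ ()

-- Restricted edge cuts of the product

module RestrictedCuts (G : Graph m) (conn : Connected G) (2≤m : 2 ≤ m) (n : ℕ) (4≤n : 4 ≤ n) where

  open Graph G using (degree)
  open Cuts G
  open Weights G

  open Blowup G n

  module ⊠ = Cuts (G ⊠ K n)

  deg≥1 : ∀ x → 1 ≤ degree x
  deg≥1 x = degree-positive (proj₂ (neighbour conn (proj₂ (other 2≤m x))))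

  vertex : Fin m
  vertex = some 2≤m
    where
    some : ∀ {m} → 2 ≤ m → Fin m
    some (s≤s _) = zero

  bound : ℕ
  bound = (n ^ 2 * edgeConnectivity G) ⊓ ((n ∸ 1) * (m + 2 * e G)) ⊓ (2 * n * δ G + 2 * n ∸ 4)

  edge-bound : ∀ p q → (∀ x → p x + q x ≡ n) → (∀ x → 1 ≤ q x) → 2 ≤ ∑ p →
    2 * n * δ G + 2 * n ∸ 4 ≤ blowupCut p q
  edge-bound p q p+q q≥1 ∑p≥2 = m≤n+o⇒m∸n≤o (2 * n * δ G + 2 * n) 4
    (blowupCut≥edge-degree p q p+q q≥1 (≤-trans (n≤1+n 3) 4≤n) deg≥1 ∑p≥2)

  bound≤blowupCut : ∀ p q → (∀ x → p x + q x ≡ n) → 2 ≤ ∑ p → 2 ≤ ∑ q → bound ≤ blowupCut p q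
  bound≤blowupCut p q p+q ∑p≥2 ∑q≥2 = by-cases (any? λ x → q x ℕ.≟ 0) (any? λ x → p x ℕ.≟ 0)
    where
    open ≤-Reasoning
    square : ∀ a b → a * (a * 1) * b ≡ a * (a * b)
    square = solve-∀

    by-cases : Dec (∃ λ x → q x ≡ 0) → Dec (∃ λ x → p x ≡ 0) → bound ≤ blowupCut p q
    by-cases (no q≢0) _ =
      ≤-trans (m⊓n≤n _ _) (edge-bound p q p+q (λ x → n≢0⇒n>0 λ eq → q≢0 (x , eq)) ∑p≥2)
    -- Every fibre meets the set, so none lies in the complement, and the edge bound applies with
    -- `p` and `q` exchanged.
    by-cases (yes _) (no p≢0) = begin
      bound                     ≤⟨ m⊓n≤n _ _ ⟩
      2 * n * δ G + 2 * n ∸ 4   ≤⟨ edge-bound q p (λ x → trans (+-comm (q x) (p x)) (p+q x))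
                                     (λ x → n≢0⇒n>0 λ eq → p≢0 (x , eq)) ∑q≥2 ⟩
      blowupCut q p             ≡⟨ blowupCut-sym q p ⟩
      blowupCut p q             ∎
    by-cases (yes (u , qu≡0)) (yes (v , pv≡0)) = begin
      bound                          ≤⟨ ≤-trans (m⊓n≤m _ _) (m⊓n≤m _ _) ⟩
      n ^ 2 * edgeConnectivity G     ≡⟨ square n (edgeConnectivity G) ⟩
      n * (n * edgeConnectivity G)   ≤⟨ blowupCut≥n²λ p q p+q pu≡n pv≡0 ⟩
      blowupCut p q                  ∎
      where
      pu≡n : p u ≡ n
      pu≡n = trans (sym (+-identityʳ (p u))) (trans (cong (p u +_) (sym qu≡0)) (p+q u))

  bound≤restricted : ∀ S → IsRestrictedEdgeCut (G ⊠ K n) S → bound ≤ ∣ S ∣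
  bound≤restricted S restricted =
    let A , cut≤ , in≥2 , out≥2 = ⊠.restrictedEdgeCut-component S restricted
    in ≤-trans (bound≤blowupCut (inFibre A) (outFibre A) (inFibre+outFibre A)
                 (subst (2 ≤_) (∑-combine m n (λ u → 𝟙 (A u))) in≥2)
                 (subst (2 ≤_) (∑-combine m n (λ u → 𝟙 (not (A u)))) out≥2))
               (≤-trans (≤-reflexive (sym (cutSize-⊠ A))) cut≤)

  -- The weights p = 1, q = n ∸ 1 are those of a single layer V(G) × {i},
  -- so the second term of the minimum never lies below the third.
  edge-bound≤layer : 2 * n * δ G + 2 * n ∸ 4 ≤ (n ∸ 1) * (m + 2 * e G)
  edge-bound≤layer = begin
    2 * n * δ G + 2 * n ∸ 4
      ≤⟨ edge-bound (λ _ → 1) (λ _ → n ∸ 1) (λ _ → m+[n∸m]≡n (≤-trans (s≤s z≤n) 4≤n)) (λ _ → m<n⇒0<n∸m (≤-trans (s≤s (s≤s z≤n)) 4≤n))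
           (≤-trans 2≤m (≤-reflexive (sym (trans (∑-const m 1) (*-identityʳ m))))) ⟩
    ∑[ x < m ] (1 * (n ∸ 1)) + adjSum (λ _ _ → 1 * (n ∸ 1))
      ≡⟨ cong₂ _+_ (trans (∑-const m _) (cong (m *_) (*-identityˡ (n ∸ 1)))) (trans (sum-cong-≗ λ x → sum-cong-≗ λ y → cong (adj x y *_) (*-comm 1 (n ∸ 1)))
           (trans (adjSum-const (n ∸ 1) (λ _ _ → 1)) (cong ((n ∸ 1) *_) handshake))) ⟩
    m * (n ∸ 1) + (n ∸ 1) * (2 * e G)
      ≡⟨ cong (_+ (n ∸ 1) * (2 * e G)) (*-comm m (n ∸ 1)) ⟩
    (n ∸ 1) * m + (n ∸ 1) * (2 * e G)
      ≡⟨ *-distribˡ-+ (n ∸ 1) m (2 * e G) ⟨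
    (n ∸ 1) * (m + 2 * e G) ∎
    where open ≤-Reasoning

  -- The cylinder over `T` fills or misses each fibre, so no boundary edge lies within a fibre, and
  -- each edge of `G` leaving `T` gives `n ^ 2` boundary edges.
  cylinder-cut : ∀ T {u v} → T u ≡ true → T v ≡ false →
    ∃ λ S → IsRestrictedEdgeCut (G ⊠ K n) S × ∣ S ∣ ≤ n ^ 2 * cutSize T
  cylinder-cut T {u} {v} Tu Tv =
    ⊠.boundary (lift B) ,
    -- Any vertex of `K n` would do here; `low-true` supplies one. As `B` is constant on fibres, any
    -- second vertex of the fibre serves as twin.
    lift-restricted B {u} {proj₁ (low-true 4≤n)} {v} {proj₁ (low-true 4≤n)} Tu Tv
      (λ x i → proj₁ (twin 4≤n i) , proj₁ (proj₂ (twin 4≤n i)) , refl) ,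
    ≤-reflexive (trans (⊠.∣boundary∣ (lift B)) (trans (cutSize-lift B) size))
    where
    open ≡-Reasoning
    B : Fin m → Fin n → Bool
    B x _ = T x

    scale : ∀ n a b → n * a * (n * b) ≡ n * (n * 1) * (a * b)
    scale = solve-∀

    size : blowupCut (λ x → ∑[ i < n ] 𝟙 (T x)) (λ x → ∑[ i < n ] 𝟙 (not (T x))) ≡ n ^ 2 * cutSize T
    size = begin
      ∑[ x < m ] (∑[ i < n ] 𝟙 (T x) * ∑[ i < n ] 𝟙 (not (T x)))
        + adjSum (λ x y → ∑[ i < n ] 𝟙 (T x) * ∑[ i < n ] 𝟙 (not (T y)))
        ≡⟨ cong₂ _+_ (sum-cong-≗ λ x → product x x) (sum-cong-≗ λ x → sum-cong-≗ λ y → cong (adj x y *_) (product x y)) ⟩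
      ∑[ x < m ] (n ^ 2 * (𝟙 (T x) * 𝟙 (not (T x)))) + adjSum (λ x y → n ^ 2 * (𝟙 (T x) * 𝟙 (not (T y))))
        ≡⟨ cong₂ _+_ (trans (sum-cong-≗ λ x → trans (cong (n ^ 2 *_) (𝟙-excluded (T x))) (*-zeroʳ (n ^ 2))) (sum-replicate-zero m))
             (adjSum-const (n ^ 2) (λ x y → 𝟙 (T x) * 𝟙 (not (T y)))) ⟩
      n ^ 2 * cutSize T ∎
      where
      product : ∀ x y → ∑[ i < n ] 𝟙 (T x) * ∑[ i < n ] 𝟙 (not (T y)) ≡ n ^ 2 * (𝟙 (T x) * 𝟙 (not (T y)))
      product x y = trans (cong₂ _*_ (∑-const n (𝟙 (T x))) (∑-const n (𝟙 (not (T y))))) (scale n (𝟙 (T x)) (𝟙 (not (T y))))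

  -- The set consists of two vertices of the fibre over `x₀`. It sends `2 * (n - 2)` edges to the
  -- rest of that fibre and `2 * n` to each of the `degree x₀` neighbouring fibres.
  edge-cut : ∀ x₀ → ∃ λ S → IsRestrictedEdgeCut (G ⊠ K n) S × ∣ S ∣ ≤ 2 * n * degree x₀ + 2 * n ∸ 4
  edge-cut x₀ = ⊠.boundary (lift B) , lift-restricted B {x₀} {proj₁ (low-true 4≤n)} {x₀} {proj₁ (low-false 4≤n)} B-in B-out B-twin , (begin
    ∣ ⊠.boundary (lift B) ∣
      ≡⟨ trans (⊠.∣boundary∣ (lift B)) (cutSize-lift B) ⟩
    blowupCut p q
      ≡⟨ cong₂ _+_ (sum-cong-≗ λ x → trans (cong (_* q x) (p≡ x)) (*-assoc (𝟙 (does (x ≟ x₀))) 2 (q x)))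
           (sum-cong-≗ pull) ⟩
    ∑[ x < m ] (𝟙 (does (x ≟ x₀)) * (2 * q x)) + ∑[ x < m ] (𝟙 (does (x ≟ x₀)) * ∑[ y < m ] (adj x y * (2 * q y)))
      ≡⟨ cong₂ _+_ (∑-indicator x₀ (λ x → 2 * q x)) (∑-indicator x₀ (λ x → ∑[ y < m ] (adj x y * (2 * q y)))) ⟩
    2 * q x₀ + ∑[ y < m ] (adj x₀ y * (2 * q y))
      ≤⟨ +-mono-≤ (≤-refl) (∑-mono-≤ λ y → *-monoʳ-≤ (adj x₀ y) (*-monoʳ-≤ 2 (q≤n y))) ⟩
    2 * q x₀ + ∑[ y < m ] (adj x₀ y * (2 * n))
      ≡⟨ cong (2 * q x₀ +_) (trans (sym (*-distribʳ-sum (2 * n) (adj x₀))) (cong (_* (2 * n)) (sym (degree-∑ x₀)))) ⟩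
    2 * q x₀ + degree x₀ * (2 * n)
      -- The added 4 completes `2 * q x₀`, where `q x₀ + 2` is `n`, to `2 * n`.
      ≡⟨ m+n∸n≡m _ 4 ⟨
    2 * q x₀ + degree x₀ * (2 * n) + 4 ∸ 4
      ≡⟨ cong (_∸ 4) (trans (rearrange (q x₀) (degree x₀) n) (cong (λ t → 2 * n * degree x₀ + 2 * t) q-x₀)) ⟩
    2 * n * degree x₀ + 2 * n ∸ 4 ∎)
    where
    open ≤-Reasoning
    B : Fin m → Fin n → Bool
    B x i = does (x ≟ x₀) ∧ low i

    x₀-fibre : ∀ i → B x₀ i ≡ low i
    x₀-fibre i = cong (_∧ low i) (dec-true (x₀ ≟ x₀) refl)

    B-in : B x₀ (proj₁ (low-true 4≤n)) ≡ true
    B-in = trans (x₀-fibre _) (proj₂ (low-true 4≤n))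

    B-out : B x₀ (proj₁ (low-false 4≤n)) ≡ false
    B-out = trans (x₀-fibre _) (proj₂ (low-false 4≤n))

    B-twin : ∀ x i → ∃ λ j → i ≢ j × B x i ≡ B x j
    B-twin x i = proj₁ (twin 4≤n i) , proj₁ (proj₂ (twin 4≤n i)) , cong (does (x ≟ x₀) ∧_) (proj₂ (proj₂ (twin 4≤n i)))

    p q : Fin m → ℕ
    p x = ∑[ i < n ] 𝟙 (B x i)
    q x = ∑[ i < n ] 𝟙 (not (B x i))

    p≡ : ∀ x → p x ≡ 𝟙 (does (x ≟ x₀)) * 2
    p≡ x with does (x ≟ x₀)
    ... | true  = ∑-low 4≤n
    ... | false = sum-replicate-zero n

    q-x₀ : q x₀ + 2 ≡ n
    q-x₀ = trans (cong (_+ 2) (sum-cong-≗ λ i → cong (λ b → 𝟙 (not b)) (x₀-fibre i))) (∑-not-low 4≤n)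

    q≤n : ∀ y → q y ≤ n
    q≤n y = subst (q y ≤_) (trans (∑-const n 1) (*-identityʳ n)) (∑-mono-≤ λ i → 𝟙≤1 (not (B y i)))
      where
      𝟙≤1 : ∀ b → 𝟙 b ≤ 1
      𝟙≤1 true  = ≤-refl
      𝟙≤1 false = z≤n

    pull : ∀ x → ∑[ y < m ] (adj x y * (p x * q y)) ≡ 𝟙 (does (x ≟ x₀)) * ∑[ y < m ] (adj x y * (2 * q y))
    pull x = trans (sum-cong-≗ λ y → trans (cong (λ c → adj x y * (c * q y)) (p≡ x)) (shuffle (adj x y) (𝟙 (does (x ≟ x₀))) (q y)))
      (sym (*-distribˡ-sum (𝟙 (does (x ≟ x₀))) (λ y → adj x y * (2 * q y))))
      where
      shuffle : ∀ a s q → a * (s * 2 * q) ≡ s * (a * (2 * q))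
      shuffle = solve-∀

    rearrange : ∀ t d n → 2 * t + d * (2 * n) + 4 ≡ 2 * n * d + 2 * (t + 2)
    rearrange = solve-∀

  restricted-attained : ∃ λ S → IsRestrictedEdgeCut (G ⊠ K n) S × ∣ S ∣ ≤ bound
  restricted-attained =
    -- The middle term needs only some restricted cut of at most its size; by `edge-bound≤layer` the
    -- cut `edge` is one.
    ⊓-attained (⊓-attained cylinder (≤-weaken edge-bound≤layer edge)) edge
    where
    ≤-weaken : ∀ {c d} → c ≤ d → (∃ λ S → IsRestrictedEdgeCut (G ⊠ K n) S × ∣ S ∣ ≤ c) → ∃ λ S → IsRestrictedEdgeCut (G ⊠ K n) S × ∣ S ∣ ≤ d
    ≤-weaken c≤d (S , restricted , S≤) = S , restricted , ≤-trans S≤ c≤d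

    cylinder : ∃ λ S → IsRestrictedEdgeCut (G ⊠ K n) S × ∣ S ∣ ≤ n ^ 2 * edgeConnectivity G
    cylinder =
      let T , T≤λ , (_ , Tu) , (_ , Tv) = edgeConnectivity-attained (proj₂ (other 2≤m vertex))
      in ≤-weaken (*-monoʳ-≤ (n ^ 2) T≤λ) (cylinder-cut T Tu Tv)

    edge : ∃ λ S → IsRestrictedEdgeCut (G ⊠ K n) S × ∣ S ∣ ≤ 2 * n * δ G + 2 * n ∸ 4
    edge =
      let x₀ , deg≡δ = proj₁ (δ-spec vertex)
      in ≤-weaken (≤-reflexive (cong (λ d → 2 * n * d + 2 * n ∸ 4) deg≡δ)) (edge-cut x₀)

theorem3p7 : ∀ (m : ℕ) (G : Graph m) → Connected G → 2 ≤ m → ∀ (n : ℕ) → 4 ≤ n →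
    restrictedEdgeConnectivity (G ⊠ K n)
    ≡ just ((n ^ 2 * edgeConnectivity G) ⊓ ((n ∸ 1) * (m + 2 * e G)) ⊓ (2 * n * δ G + 2 * n ∸ 4))
theorem3p7 m G conn 2≤m n 4≤n =
  minimum-size (isRestrictedEdgeCut? (G ⊠ K n)) (RestrictedCuts.restricted-attained G conn 2≤m n 4≤n) (RestrictedCuts.bound≤restricted G conn 2≤m n 4≤n)
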